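{- Let $g \geq 2$ be an integer and let $f\colon \mathbb{N}\to\mathbb{N}$ be a positive-integer-valued arithmetic function. Suppose that $f$ is of weakly polynomial growth, i.e. there are constants $c>0$, $C>0$ and $x_1$ (depending on $f$) such that \[ \sum_{m \leq x} \log f(m) \geq c\, x\log x \quad \text{for all } x > x_1, \qquad\text{and}\qquad \log f(m) \leq C \log m \quad\text{for all } m\in\mathbb{N}. \] Suppose moreover that for every meager set $\mathcal{E}\subset\mathbb{N}$, the inverse image $f^{ -1}(\mathcal{E})=\{n\in\mathbb{N}: f(n)\in\mathcal{E}\}$ has asymptotic density zero. Then the real number \[ \alpha_f := 0.f(1) f(2) f(3) \ldots, \] obtained by concatenating the base-$g$ digits of $f(1), f(2), f(3), \dots$ in succession, is $g$-normal.
   Context: Throughout, $\ln x$ is the natural logarithm and $\log x := \max\{1, \ln x\}$. A set $\mathcal{E}\subset\mathbb{N}$ is called meager if there exist $\delta<1$ and $x_0>0$ such that $\#(\mathcal{E}\cap[1,x]) < x^{\delta}$ for all $x > x_0$. The asymptotic density of $\mathcal{S}\subset\mathbb{N}$ is $\lim_{x\to\infty}\#(\mathcal{S}\cap[1,x])/x$ when it exists. A real number is $g$-normal if, for every $k\ge1$, every word of length $k$ on the alphabet $\{0,1,\dots,g-1\}$ occurs in its base-$g$ expansion with limiting frequency $g^{ -k}$. -}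

module Defs where

open import Data.Nat using (ℕ; zero; suc; _+_; _*_; _∸_; _^_; _≤_; _<_; _≥_; _>_; ∣_-_∣; _⊔_)
open import Data.Nat.DivMod using (_/_; _%_)
open import Data.Bool using (Bool; true; false; if_then_else_)
open import Data.List using (List; []; _∷_; _++_; [_]; concat; map; length; lookup)
open import Data.Product using (Σ; _×_; ∃; ∃-syntax; _,_)
open import Data.Vec using (Vec; toList)
open import Data.Fin using (Fin; toℕ)
open import Relation.Binary.PropositionalEquality using (_≡_)
open import Relation.Nullary.Decidable using (⌊_⌋)
open import Data.Nat using (_≟_; _<?_)
import Data.Nat as N

-- Base-g digits (most significant first) of n ≥ 1, for g ≥ 2.
-- The first argument is fuel; n itself is sufficient fuel.

digitsFuel : ℕ → ℕ → ℕ → List ℕ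
digitsFuel zero          g       n = []
digitsFuel (suc k)       zero    n = []
digitsFuel (suc k)       (suc h) zero = []
digitsFuel (suc k) (suc h) (suc n) =
  digitsFuel k (suc h) (suc n / suc h) ++ [ suc n % suc h ]

digits : ℕ → ℕ → List ℕ
digits g n = digitsFuel n g n

prefixDigits : ℕ → (ℕ → ℕ) → ℕ → List ℕ
prefixDigits g f zero    = []
prefixDigits g f (suc N) = prefixDigits g f N ++ digits g (f (suc N))

nth : ℕ → List ℕ → ℕ
nth i       []       = 0
nth zero    (x ∷ xs) = x
nth (suc i) (x ∷ xs) = nth i xs

-- the p-th digit (p = 0,1,2,...) after the radix point of α_f.
-- Since every f(m) ≥ 1 has at least one digit, the concatenation of the
-- digits of f(1),...,f(p+1) already has length ≥ p+1.
alphaDigit : ℕ → (ℕ → ℕ) → ℕ → ℕ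
alphaDigit g f p = nth p (prefixDigits g f (suc p))

occursAt : (ℕ → ℕ) → List ℕ → ℕ → Bool
occursAt d []       i = true
occursAt d (x ∷ w)  i = if ⌊ d i ≟ x ⌋ then occursAt d w (suc i) else false

occCount : (ℕ → ℕ) → List ℕ → ℕ → ℕ
occCount d w zero    = 0
occCount d w (suc N) = occCount d w N + (if occursAt d w N then 1 else 0)

word : (g k : ℕ) → Vec (Fin g) k → List ℕ
word g k v = Data.List.map toℕ (toList v)

-- g-normality of a digit sequence d : every word w of length k ≥ 1
-- occurs with limiting frequency g^{-k}, i.e. occCount d w N / N → g^{-k}.
-- Limit stated with ε = 1/r:  |occ/N - g^{-k}| ≤ 1/r
--   ⟺  r * |g^k * occ - N| ≤ g^k * N.
IsNormalSeq : ℕ → (ℕ → ℕ) → Set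
IsNormalSeq g d =
  (k : ℕ) → 1 ≤ k → (w : Vec (Fin g) k) →
  (r : ℕ) → 1 ≤ r →
  ∃[ N₀ ] ((N : ℕ) → N₀ ≤ N → 1 ≤ N →
     r * ∣ g ^ k * occCount d (word g k w) N - N ∣ ≤ g ^ k * N)

count : (ℕ → Bool) → ℕ → ℕ
count E zero    = 0
count E (suc n) = count E n + (if E (suc n) then 1 else 0)

-- E is meager: ∃ δ < 1, x₀ with #(E ∩ [1,x]) < x^δ for x > x₀.
-- δ = a/b rational (a < b), and x^δ > c ⟺ x^a > c^b.
Meager : (ℕ → Bool) → Set
Meager E = ∃[ a ] ∃[ b ] (a < b × ∃[ x₀ ] ((x : ℕ) → x₀ < x → count E x ^ b < x ^ a))

DensityZero : (ℕ → Bool) → Set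
DensityZero S = (r : ℕ) → 1 ≤ r → ∃[ x₀ ] ((x : ℕ) → x₀ ≤ x → r * count S x ≤ x)

preimage : (ℕ → ℕ) → (ℕ → Bool) → (ℕ → Bool)
preimage f E n = E (f n)

prod3 : (ℕ → ℕ) → ℕ → ℕ
prod3 f zero    = 1
prod3 f (suc n) = prod3 f n * (3 ⊔ f (suc n))

-- lower bound  Σ_{m ≤ x} log f(m) ≥ c x log x  (c > 0, x large), with c = 1/q
LowerGrowth : (ℕ → ℕ) → Set
LowerGrowth f = ∃[ q ] (1 ≤ q × ∃[ x₁ ] ((n : ℕ) → x₁ < n → n ^ n ≤ prod3 f n ^ q))

-- upper bound  log f(m) ≤ C log m  for all m ∈ ℕ
UpperGrowth : (ℕ → ℕ) → Set
UpperGrowth f = ∃[ K ] (1 ≤ K × ((m : ℕ) → 1 ≤ m → f m ≤ (m + 2) ^ K))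

WeaklyPolynomialGrowth : (ℕ → ℕ) → Set
WeaklyPolynomialGrowth f = LowerGrowth f × UpperGrowth f

{-# OPTIONS --safe #-}

-- Fix a word of length k, put Q = g^k, and let χ be a 0/1-valued function of the k-digit windows,
-- with s = Σ_{d<Q} χ(d).  It suffices to show that the upper density of the windows of α_f hit by χ
-- is at most s/Q: apply this to the indicator of the word and to that of its complement.
-- The windows ending i digits (i < k) before the end of n, modulo k, are the base-Q digits of
-- ⌊n/gⁱ⌋.  Weighting every base-Q digit d by B + Rχ(d), the total weight of the numbers of M digits
-- is (QB + Rs)^M, so by Markov's inequality all but a power-saving set of integers have at most
-- (s/Q + 1/R)·(number of digits) hits.  By hypothesis the m ≤ x for which ⌊f(m)/gⁱ⌋ is
-- exceptional have density zero, so they contribute o(x log x) digits; so do the windows that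
-- straddle two blocks, while the first x blocks have at least a constant times x log x digits.

module Submission where

open import Defs
open import Data.Nat
open import Data.Nat.Properties
open import Data.Nat.DivMod
open import Data.Nat.Tactic.RingSolver using (solve-∀)
open import Data.Bool using (Bool; true; false; not; if_then_else_)
open import Data.Fin using (Fin; toℕ)
open import Data.Fin.Properties using (toℕ<n)
open import Data.List using (List; []; _∷_; _++_; [_]; length)
open import Data.List.Properties using (length-++; length-map)
open import Data.List.Relation.Unary.All as All using (All; []; _∷_)
open import Data.List.Relation.Unary.All.Properties using () renaming (++⁺ to All-++⁺; map⁺ to All-map⁺)
open import Data.Product using (_×_; _,_; proj₁; proj₂; ∃-syntax)
open import Data.Sum using (inj₁; inj₂)
open import Data.Vec using (Vec; toList)
open import Data.Vec.Properties using (length-toList)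
open import Function using (_∘_; id)
open import Relation.Nullary using (¬_; Dec; yes; no; contradiction)
open import Relation.Nullary.Decidable using (⌊_⌋)
open import Relation.Binary.PropositionalEquality using (_≡_; refl; sym; trans; cong; cong₂; subst)

-- Overlapping windows are not independent, whereas the base-Q digits of a single ⌊n/gⁱ⌋ are; this
-- is what lets a weight be a product over digits and the total weight factor. Scaled by Q, the
-- digit weights have integer average u = QB + Rs, and a number padded to M digits is exceptional
-- when its weight exceeds (u+1)^M. The gap between u and u+1 bounds the exceptional proportion
-- below Q^M by 4(u/(u+1))^M, which is the power saving; the excess 1/R in the hit density is what
-- pays for that gap. Integers below Q^M have different lengths, so leading zeros need a weight as
-- well. The weight u+1 makes them neutral against the threshold, and the extra total weight it
-- creates stays within a constant multiple of (Qu)^M. Everything is stated in ℕ: ratios are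
-- cross-multiplied, and the fractional exponent s/Q + 1/R is cleared by taking QR-th powers.

-- Finite sums and division into blocks.

bit : Bool → ℕ
bit b = if b then 1 else 0

∑ : ℕ → (ℕ → ℕ) → ℕ
∑ zero    F = 0
∑ (suc n) F = ∑ n F + F n

∑-mono-< : ∀ n {F G} → (∀ i → i < n → F i ≤ G i) → ∑ n F ≤ ∑ n G
∑-mono-< zero    p = z≤n
∑-mono-< (suc n) p = +-mono-≤ (∑-mono-< n λ i q → p i (m<n⇒m<1+n q)) (p n ≤-refl)

∑-mono : ∀ n {F G} → (∀ i → F i ≤ G i) → ∑ n F ≤ ∑ n G
∑-mono n p = ∑-mono-< n λ i _ → p i

∑-cong-< : ∀ n {F G} → (∀ i → i < n → F i ≡ G i) → ∑ n F ≡ ∑ n G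
∑-cong-< zero    p = refl
∑-cong-< (suc n) p = cong₂ _+_ (∑-cong-< n λ i q → p i (m<n⇒m<1+n q)) (p n ≤-refl)

∑-cong : ∀ n {F G} → (∀ i → F i ≡ G i) → ∑ n F ≡ ∑ n G
∑-cong n p = ∑-cong-< n λ i _ → p i

+-interchange : ∀ a b c d → (a + b) + (c + d) ≡ (a + c) + (b + d)
+-interchange = solve-∀

*-interchange : ∀ a b c d → (a * b) * (c * d) ≡ (a * c) * (b * d)
*-interchange = solve-∀

∑-+ : ∀ n F G → ∑ n (λ i → F i + G i) ≡ ∑ n F + ∑ n G
∑-+ zero    F G = refl
∑-+ (suc n) F G = trans (cong (_+ (F n + G n)) (∑-+ n F G)) (+-interchange (∑ n F) (∑ n G) (F n) (G n))

∑-*ˡ : ∀ n c F → ∑ n (λ i → c * F i) ≡ c * ∑ n F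
∑-*ˡ zero    c F = sym (*-zeroʳ c)
∑-*ˡ (suc n) c F = trans (cong (_+ c * F n) (∑-*ˡ n c F)) (sym (*-distribˡ-+ c (∑ n F) (F n)))

∑-const : ∀ n c → ∑ n (λ _ → c) ≡ n * c
∑-const zero    c = refl
∑-const (suc n) c = trans (cong (_+ c) (∑-const n c)) (+-comm (n * c) c)

∑-split : ∀ a b F → ∑ (a + b) F ≡ ∑ a F + ∑ b (λ i → F (a + i))
∑-split a zero    F rewrite +-identityʳ a = sym (+-identityʳ _)
∑-split a (suc b) F rewrite +-suc a b =
  trans (cong (_+ F (a + b)) (∑-split a b F)) (+-assoc (∑ a F) _ _)

∑-first : ∀ n F → ∑ (suc n) F ≡ F 0 + ∑ n (F ∘ suc)
∑-first n F = ∑-split 1 n F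

∑-extend : ∀ {m n} F → m ≤ n → ∑ m F ≤ ∑ n F
∑-extend {m} {n} F m≤n = begin
  ∑ m F             ≤⟨ m≤m+n _ _ ⟩
  ∑ m F + _         ≡⟨ ∑-split m (n ∸ m) F ⟨
  ∑ (m + (n ∸ m)) F ≡⟨ cong (λ z → ∑ z F) (m+[n∸m]≡n m≤n) ⟩
  ∑ n F             ∎
  where open ≤-Reasoning

∑-swap : ∀ a b (F : ℕ → ℕ → ℕ) → ∑ a (λ i → ∑ b (F i)) ≡ ∑ b (λ j → ∑ a (λ i → F i j))
∑-swap zero    b F = sym (trans (∑-const b 0) (*-zeroʳ b))
∑-swap (suc a) b F = trans (cong (_+ ∑ b (F a)) (∑-swap a b F)) (sym (∑-+ b _ (F a)))

term≤∑ : ∀ n F i → i < n → F i ≤ ∑ n F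
term≤∑ (suc n) F i i<1+n with m≤n⇒m<n∨m≡n (s≤s⁻¹ i<1+n)
... | inj₁ i<n  = ≤-trans (term≤∑ n F i i<n) (m≤m+n _ _)
... | inj₂ refl = m≤n+m _ _

∑-blocks : ∀ X Q F → ∑ (X * Q) F ≡ ∑ X (λ x → ∑ Q (λ d → F (x * Q + d)))
∑-blocks zero    Q F = refl
∑-blocks (suc X) Q F = trans (cong (λ z → ∑ z F) (+-comm Q (X * Q)))
  (trans (∑-split (X * Q) Q F) (cong (_+ ∑ Q (λ d → F (X * Q + d))) (∑-blocks X Q F)))

divides-block : ∀ Q .{{_ : NonZero Q}} x d → d < Q → (x * Q + d) / Q ≡ x
divides-block Q x d d<Q = *-cancelʳ-≡ _ _ Q (+-cancelˡ-≡ d _ _ (begin-equality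
  d + (x * Q + d) / Q * Q                   ≡⟨ cong (_+ (x * Q + d) / Q * Q) (sym r) ⟩
  (x * Q + d) % Q + (x * Q + d) / Q * Q     ≡⟨ m≡m%n+[m/n]*n (x * Q + d) Q ⟨
  x * Q + d                                 ≡⟨ +-comm (x * Q) d ⟩
  d + x * Q                                 ∎))
  where
  open ≤-Reasoning
  r : (x * Q + d) % Q ≡ d
  r = trans (cong (_% Q) (+-comm (x * Q) d)) (trans ([m+kn]%n≡m%n d x Q) (m<n⇒m%n≡m d<Q))

block-% : ∀ Q .{{_ : NonZero Q}} x d → d < Q → (x * Q + d) % Q ≡ d
block-% Q x d d<Q =
  trans (cong (_% Q) (+-comm (x * Q) d)) (trans ([m+kn]%n≡m%n d x Q) (m<n⇒m%n≡m d<Q))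

∑-quotients : ∀ X Q .{{_ : NonZero Q}} F → ∑ (X * Q) (λ n → F (n / Q)) ≡ Q * ∑ X F
∑-quotients X Q F = trans (∑-blocks X Q (λ n → F (n / Q)))
  (trans (∑-cong X λ x → trans (∑-cong-< Q λ d d<Q → cong F (divides-block Q x d d<Q)) (∑-const Q (F x)))
         (∑-*ˡ X Q F))

-- Sums and products over the truncations of an integer.

-- T F b φ n = Σ_{j<F} φ(⌊n/bʲ⌋) and Π F b ψ n = Π_{j<F} ψ(⌊n/bʲ⌋); when φ vanishes at 0
-- and F ≥ n, the former is the sum of φ over the nonzero truncations of n.

T : ℕ → (b : ℕ) .{{_ : NonZero b}} → (ℕ → ℕ) → ℕ → ℕ
T zero    b φ n = 0
T (suc F) b φ n = φ n + T F b φ (n / b)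

Π : ℕ → (b : ℕ) .{{_ : NonZero b}} → (ℕ → ℕ) → ℕ → ℕ
Π zero    b ψ n = 1
Π (suc F) b ψ n = ψ n * Π F b ψ (n / b)

module _ (b : ℕ) .{{_ : NonZero b}} where

  T-mono : ∀ F {φ φ′} → (∀ y → φ y ≤ φ′ y) → ∀ n → T F b φ n ≤ T F b φ′ n
  T-mono zero    p n = z≤n
  T-mono (suc F) p n = +-mono-≤ (p n) (T-mono F p (n / b))

  T-*ˡ : ∀ F c φ n → T F b (λ y → c * φ y) n ≡ c * T F b φ n
  T-*ˡ zero    c φ n = sym (*-zeroʳ c)
  T-*ˡ (suc F) c φ n = trans (cong (c * φ n +_) (T-*ˡ F c φ (n / b))) (sym (*-distribˡ-+ c (φ n) _))

  T-zero : ∀ F φ → φ 0 ≡ 0 → T F b φ 0 ≡ 0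
  T-zero zero    φ φ0 = refl
  T-zero (suc F) φ φ0 = trans (cong₂ _+_ φ0 (cong (T F b φ) (0/n≡0 b))) (T-zero F φ φ0)

  Π-mono : ∀ F {ψ ψ′} → (∀ y → ψ y ≤ ψ′ y) → ∀ n → Π F b ψ n ≤ Π F b ψ′ n
  Π-mono zero    p n = ≤-refl
  Π-mono (suc F) p n = *-mono-≤ (p n) (Π-mono F p (n / b))

  Π-* : ∀ F ψ ψ′ n → Π F b (λ y → ψ y * ψ′ y) n ≡ Π F b ψ n * Π F b ψ′ n
  Π-* zero    ψ ψ′ n = refl
  Π-* (suc F) ψ ψ′ n = trans (cong (ψ n * ψ′ n *_) (Π-* F ψ ψ′ (n / b)))
    (*-interchange (ψ n) (ψ′ n) _ _)

  Π-const : ∀ F c n → Π F b (λ _ → c) n ≡ c ^ F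
  Π-const zero    c n = refl
  Π-const (suc F) c n = cong (c *_) (Π-const F c (n / b))

  Π-^ : ∀ F ψ D n → Π F b (λ y → ψ y ^ D) n ≡ Π F b ψ n ^ D
  Π-^ F ψ zero    n = trans (Π-const F 1 n) (^-zeroˡ F)
  Π-^ F ψ (suc D) n = trans (Π-* F ψ (λ y → ψ y ^ D) n) (cong (Π F b ψ n *_) (Π-^ F ψ D n))

  Π-exp : ∀ F c φ n → Π F b (λ y → c ^ φ y) n ≡ c ^ T F b φ n
  Π-exp zero    c φ n = refl
  Π-exp (suc F) c φ n = trans (cong (c ^ φ n *_) (Π-exp F c φ (n / b))) (sym (^-distribˡ-+-* c (φ n) _))

  Π-zero : ∀ F ψ → Π F b ψ 0 ≡ ψ 0 ^ F
  Π-zero zero    ψ = refl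
  Π-zero (suc F) ψ = cong (ψ 0 *_) (trans (cong (Π F b ψ) (0/n≡0 b)) (Π-zero F ψ))

  quotient<^ : ∀ F n → n < b ^ suc F → n / b < b ^ F
  quotient<^ F n p = m<n*o⇒m/o<n (subst (n <_) (*-comm b (b ^ F)) p)

  Π-+ : ∀ M j ψ n → n < b ^ M → Π (M + j) b ψ n ≡ Π M b ψ n * ψ 0 ^ j
  Π-+ zero    j ψ n p rewrite n<1⇒n≡0 p = trans (Π-zero j ψ) (sym (*-identityˡ _))
  Π-+ (suc M) j ψ n p = trans (cong (ψ n *_) (Π-+ M j ψ (n / b) (quotient<^ M n p))) (sym (*-assoc (ψ n) _ _))

  -- Both sides are the product over M + N positions, since each padding position contributes a
  -- factor `ψ 0`. Hence the ratio of `Π M b ψ n` to `ψ 0 ^ M` does not depend on the padding.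
  Π-fuel : ∀ M N ψ n → n < b ^ M → n < b ^ N → Π M b ψ n * ψ 0 ^ N ≡ Π N b ψ n * ψ 0 ^ M
  Π-fuel M N ψ n p q = trans (sym (Π-+ M N ψ n p))
    (trans (cong (λ z → Π z b ψ n) (+-comm M N)) (Π-+ N M ψ n q))

  T-+ : ∀ M j φ → φ 0 ≡ 0 → ∀ n → n < b ^ M → T (M + j) b φ n ≡ T M b φ n
  T-+ zero    j φ φ0 n p rewrite n<1⇒n≡0 p = T-zero j φ φ0
  T-+ (suc M) j φ φ0 n p = cong (φ n +_) (T-+ M j φ φ0 (n / b) (quotient<^ M n p))

  -- This is ⌊n/bⁱ⌋, written as iterated division so that it unfolds in step with `T` and `Π`.
  shift : ℕ → ℕ → ℕ
  shift zero    n = n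
  shift (suc i) n = shift i (n / b)

  shift-suc : ∀ i n → shift i (n / b) ≡ shift i n / b
  shift-suc zero    n = refl
  shift-suc (suc i) n = shift-suc i (n / b)

  shift-comm : ∀ i j n → shift i (shift j n) ≡ shift j (shift i n)
  shift-comm zero    j n = refl
  shift-comm (suc i) j n = trans (cong (shift i) (sym (shift-suc j n))) (shift-comm i j (n / b))

  shift≤ : ∀ i n → shift i n ≤ n
  shift≤ zero    n = ≤-refl
  shift≤ (suc i) n = ≤-trans (shift≤ i (n / b)) (m/n≤m n b)

  shift≡/ : ∀ i Q .{{_ : NonZero Q}} → Q ≡ b ^ i → ∀ n → shift i n ≡ n / Q
  shift≡/ zero    .1           refl n = sym (n/1≡n n)
  shift≡/ (suc i) .(b * b ^ i) refl n =
    trans (shift≡/ i (b ^ i) {{m^n≢0 b i}} refl (n / b)) (m/n/o≡m/[n*o] n b (b ^ i) {{_}} {{m^n≢0 b i}})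

  -- Each y < X equals ⌊n/bⁱ⌋ for exactly bⁱ of the n < X bⁱ.
  ∑-shift : ∀ X i F → ∑ (X * b ^ i) (λ n → F (shift i n)) ≡ b ^ i * ∑ X F
  ∑-shift X zero    F = trans (cong (λ z → ∑ z F) (*-identityʳ X)) (sym (+-identityʳ _))
  ∑-shift X (suc i) F =
    trans (cong (λ z → ∑ z (λ n → F (shift i (n / b)))) (trans (cong (X *_) (*-comm b (b ^ i))) (sym (*-assoc X _ b))))
    (trans (∑-quotients (X * b ^ i) b (F ∘ shift i))
    (trans (cong (b *_) (∑-shift X i F)) (sym (*-assoc b _ _))))

  T-concat : ∀ M N φ n → T (M + N) b φ n ≡ T M b φ n + T N b φ (shift M n)
  T-concat zero    N φ n = refl
  T-concat (suc M) N φ n = trans (cong (φ n +_) (T-concat M N φ (n / b))) (sym (+-assoc (φ n) _ _))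

  T-as-∑ : ∀ M φ n → T M b φ n ≡ ∑ M (λ i → φ (shift i n))
  T-as-∑ zero    φ n = refl
  T-as-∑ (suc M) φ n = trans (cong (φ n +_) (T-as-∑ M φ (n / b))) (sym (∑-first M (λ i → φ (shift i n))))

-- The positions below F k are sorted by residue i modulo k: position i + jk is reached by i
-- divisions by g followed by j divisions by Q.
T-residues : ∀ g .{{_ : NonZero g}} k Q .{{_ : NonZero Q}} → Q ≡ g ^ k → ∀ F φ n →
             T (F * k) g φ n ≡ ∑ k (λ i → T F Q φ (shift g i n))
T-residues g k Q Q≡ zero    φ n = sym (trans (∑-const k 0) (*-zeroʳ k))
T-residues g k Q Q≡ (suc F) φ n =
  trans (T-concat g k (F * k) φ n)
  (trans (cong₂ _+_ (T-as-∑ g k φ n) (T-residues g k Q Q≡ F φ (shift g k n)))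
  (trans (sym (∑-+ k _ _))
  (∑-cong k λ i → cong (λ z → φ (shift g i n) + T F Q φ z)
    (trans (shift-comm g i k n) (shift≡/ g k Q Q≡ (shift g i n))))))

-- Powers, Bernoulli inequalities and the tilt inequality.

*-cancelˡ-≤′ : ∀ c {m n} → 0 < c → c * m ≤ c * n → m ≤ n
*-cancelˡ-≤′ c c>0 = *-cancelˡ-≤ c {{>-nonZero c>0}}

^-distribʳ-* : ∀ m n o → (m * n) ^ o ≡ m ^ o * n ^ o
^-distribʳ-* m n zero    = refl
^-distribʳ-* m n (suc o) = trans (cong (m * n *_) (^-distribʳ-* m n o)) (*-interchange m n _ _)

^-cancelʳ-≤ : ∀ c → 1 < c → ∀ {m n} → c ^ m ≤ c ^ n → m ≤ n
^-cancelʳ-≤ c c>1 p = ≮⇒≥ λ n<m → <⇒≱ (^-monoʳ-< c c>1 n<m) p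

n<b^n : ∀ b → 2 ≤ b → ∀ n → n < b ^ n
n<b^n b b≥2 zero    = s≤s z≤n
n<b^n b b≥2 (suc n) = begin-strict
  suc n           ≤⟨ n<b^n b b≥2 n ⟩
  b ^ n           <⟨ m<m+n (b ^ n) (m^n>0 b {{>-nonZero (≤-trans (s≤s z≤n) b≥2)}} n) ⟩
  b ^ n + b ^ n   ≡⟨ cong (b ^ n +_) (sym (+-identityʳ _)) ⟩
  2 * b ^ n       ≤⟨ *-monoˡ-≤ (b ^ n) b≥2 ⟩
  b * b ^ n       ∎
  where open ≤-Reasoning

-- For a > 0 this is (1 + c/a)ⁿ ≥ 1 + nc/a with the denominators cleared.
bernoulli : ∀ a c n → a ^ n * (a + n * c) ≤ a * (a + c) ^ n
bernoulli a c zero    = ≤-reflexive (lemma a)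
  where
  lemma : ∀ a → 1 * (a + 0) ≡ a * 1
  lemma = solve-∀
bernoulli a c (suc n) = begin
  a * a ^ n * (a + (c + n * c))            ≤⟨ m≤m+n _ (a ^ n * (n * c * c)) ⟩
  a * a ^ n * (a + (c + n * c)) + a ^ n * (n * c * c) ≡⟨ lemma a (a ^ n) c (n * c) ⟩
  (a + c) * (a ^ n * (a + n * c))          ≤⟨ *-monoʳ-≤ (a + c) (bernoulli a c n) ⟩
  (a + c) * (a * (a + c) ^ n)              ≡⟨ x∙yz≡y∙xz (a + c) a _ ⟩
  a * ((a + c) * (a + c) ^ n)              ∎
  where
  open ≤-Reasoning
  lemma : ∀ a A c m → a * A * (a + (c + m)) + A * (m * c) ≡ (a + c) * (A * (a + m))
  lemma = solve-∀
  x∙yz≡y∙xz : ∀ x y z → x * (y * z) ≡ y * (x * z)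
  x∙yz≡y∙xz = solve-∀

-- (1 + c/a)ⁿ ≤ 1/(1 − nc/a), with z = a − nc.
reverse-bernoulli : ∀ a c z n → a ≡ n * c + z → (a + c) ^ n * z ≤ a ^ n * a
reverse-bernoulli a c z zero    refl = ≤-refl
reverse-bernoulli a c z (suc n) a≡   = begin
  (a + c) * (a + c) ^ n * z         ≡⟨ lemma₁ a c ((a + c) ^ n) z ⟩
  (a + c) ^ n * (a * z + c * z)     ≤⟨ *-monoʳ-≤ ((a + c) ^ n) (+-monoʳ-≤ (a * z) (*-monoʳ-≤ c z≤a)) ⟩
  (a + c) ^ n * (a * z + c * a)     ≡⟨ lemma₂ a c ((a + c) ^ n) z ⟩
  a * ((a + c) ^ n * (c + z))       ≤⟨ *-monoʳ-≤ a (reverse-bernoulli a c (c + z) n (trans a≡ (lemma₃ n c z))) ⟩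
  a * (a ^ n * a)                   ≡⟨ *-assoc a _ a ⟨
  a * a ^ n * a                     ∎
  where
  open ≤-Reasoning
  z≤a : z ≤ a
  z≤a = subst (z ≤_) (sym a≡) (m≤n+m z _)
  lemma₁ : ∀ a c A z → (a + c) * A * z ≡ A * (a * z + c * z)
  lemma₁ = solve-∀
  lemma₂ : ∀ a c A z → A * (a * z + c * a) ≡ a * (A * (c + z))
  lemma₂ = solve-∀
  lemma₃ : ∀ n c z → c + n * c + z ≡ n * c + (c + z)
  lemma₃ = solve-∀

-- The exponential-moment inequality: with B large, (B + (Rs+1)/Q)/B is at most
-- ((B+R)/B) raised to the power s/Q + 1/R.
module _ (Q R s : ℕ) (Q≥2 : 2 ≤ Q) (R≥1 : 1 ≤ R) where

  private
    -- X is what QR-fold use of (Rs+1)/Q amounts to, so D = B - X is the remainder `z` of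
    -- `reverse-bernoulli`, up to the factor Q. The choice D = X² gives B² = D(B + X + 1).
    X = R * (R * s + 1)
    D = X * X

  B e U : ℕ
  B = X + D
  e = s * R + Q
  U = Q * B + R * s

  B>0 : 0 < B
  B>0 = ≤-trans (*-mono-≤ R≥1 (m≤n+m 1 (R * s))) (m≤m+n X D)

  -- In ratios: ((U+1)/QB)^(QR) is at most B/D by `reverse-bernoulli`, and ((B+R)/B)^e is at least
  -- (B+Y)/B by `bernoulli`, where Y = eR. What remains is B² ≤ D(B+Y).
  tilt : (U + 1) ^ (Q * R) * B ^ e ≤ (Q * B) ^ (Q * R) * (B + R) ^ e
  tilt = *-cancelˡ-≤′ (B * B) (*-mono-≤ B>0 B>0) (begin
    B * B * (u * b)             ≤⟨ *-monoˡ-≤ (u * b) B²≤ ⟩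
    D * (B + Y) * (u * b)       ≡⟨ lemma₁ D (B + Y) u b ⟩
    u * D * (b * (B + Y))       ≤⟨ *-mono-≤ above (bernoulli B R e) ⟩
    v * B * (B * w)             ≡⟨ lemma₂ v B w ⟩
    B * B * (v * w)             ∎)
    where
    open ≤-Reasoning
    u = (U + 1) ^ (Q * R)
    b = B ^ e
    v = (Q * B) ^ (Q * R)
    w = (B + R) ^ e
    Y = e * R
    lemma₁ : ∀ D B u b → D * B * (u * b) ≡ u * D * (b * B)
    lemma₁ = solve-∀
    lemma₂ : ∀ v B w → v * B * (B * w) ≡ B * B * (v * w)
    lemma₂ = solve-∀
    Q≡ : Q ≡ 2 + (Q ∸ 2)
    Q≡ = sym (m+[n∸m]≡n Q≥2)
    -- Y - X = R(Q - 1). The summand RQ of Y comes from the 1/R in the exponent, the summand R of X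
    -- from the 1 in U + 1: the former pays for the latter.
    X+1≤Y : X + 1 ≤ Y
    X+1≤Y = begin
      X + 1                             ≤⟨ +-monoʳ-≤ X R≥1 ⟩
      R * (R * s + 1) + R               ≡⟨ lemma R s ⟩
      (s * R + 2) * R                   ≤⟨ *-monoˡ-≤ R (+-monoʳ-≤ (s * R) Q≥2) ⟩
      (s * R + Q) * R                   ∎
      where
      lemma : ∀ R s → R * (R * s + 1) + R ≡ (s * R + 2) * R
      lemma = solve-∀
    B²≤ : B * B ≤ D * (B + Y)
    B²≤ = begin
      (X + X * X) * (X + X * X)             ≡⟨ lemma X ⟩
      X * X * (X + X * X + (X + 1))         ≤⟨ *-monoʳ-≤ D (+-monoʳ-≤ B X+1≤Y) ⟩
      D * (B + Y)                           ∎
      where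
      lemma : ∀ X → (X + X * X) * (X + X * X) ≡ X * X * (X + X * X + (X + 1))
      lemma = solve-∀
    above : u * D ≤ v * B
    above = *-cancelˡ-≤′ Q (≤-trans (s≤s z≤n) Q≥2) (begin
      Q * (u * D)                                 ≡⟨ cong (λ z → Q * (z ^ (Q * R) * D)) (+-assoc (Q * B) (R * s) 1) ⟩
      Q * ((Q * B + (R * s + 1)) ^ (Q * R) * D)   ≡⟨ lemma₃ Q ((Q * B + (R * s + 1)) ^ (Q * R)) D ⟩
      (Q * B + (R * s + 1)) ^ (Q * R) * (Q * D)   ≤⟨ reverse-bernoulli (Q * B) (R * s + 1) (Q * D) (Q * R) (lemma₄ Q R (R * s + 1) D) ⟩
      v * (Q * B)                                 ≡⟨ lemma₅ v Q B ⟩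
      Q * (v * B)                                 ∎)
      where
      lemma₃ : ∀ Q u D → Q * (u * D) ≡ u * (Q * D)
      lemma₃ = solve-∀
      lemma₄ : ∀ Q R c D → Q * (R * c + D) ≡ Q * R * c + Q * D
      lemma₄ = solve-∀
      lemma₅ : ∀ v Q B → v * (Q * B) ≡ Q * (v * B)
      lemma₅ = solve-∀

-- Digit weights, exceptional integers and Markov's inequality.

-- Vanishing at 0 makes padding invisible: leading zeros are neither digits nor hits, while a digit
-- 0 inside a number still counts. With `one` and enough fuel, `T` becomes the number of digits.
onPositive : (ℕ → ℕ) → ℕ → ℕ
onPositive χ zero    = 0
onPositive χ (suc y) = χ (suc y)

one : ℕ → ℕ
one _ = 1

module Weights (Q R : ℕ) .{{Q≢0 : NonZero Q}} (Q≥2 : 2 ≤ Q) (R≥1 : 1 ≤ R)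
               (χ : ℕ → ℕ) (χ≤1 : ∀ d → χ d ≤ 1) where

  s b u : ℕ
  s = ∑ Q χ
  b = B Q R s Q≥2 R≥1
  u = U Q R s Q≥2 R≥1
  -- The average of `Q * (b + R * χ d)` over d < Q is u. The threshold per digit is one more, and
  -- u/P < 1 is the ratio behind the power saving.
  P = u + 1
  ex = e Q R s Q≥2 R≥1

  χ% : ℕ → ℕ
  χ% y = χ (y % Q)

  -- Leading zeros get the weight P, so that comparing the weight of n with P^M
  -- does not depend on the number M of digits to which n is padded.
  h : ℕ → ℕ
  h zero    = P
  h (suc y) = Q * (b + R * χ% (suc y))

  hits len : ℕ → ℕ → ℕ
  hits F n = T F Q (onPositive χ%) n
  len  F n = T F Q (onPositive one) n

  -- With ρ = (b+R)/b, at y > 0 this says (P/h(y))^(QR) ≤ ρ^(ex - QRχ). Without a hit it is `tilt`;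
  -- a hit divides both sides by ρ^(QR). At y = 0 it is an equality because `h 0` is P.
  h-pointwise : ∀ y → P ^ (Q * R) * ((b + R) ^ (Q * R * onPositive χ% y) * b ^ (ex * onPositive one y))
                    ≤ h y ^ (Q * R) * (b ^ (Q * R * onPositive χ% y) * (b + R) ^ (ex * onPositive one y))
  h-pointwise zero rewrite *-zeroʳ (Q * R) | *-zeroʳ ex = ≤-refl
  h-pointwise (suc y) with χ% (suc y) | χ≤1 (suc y % Q)
  ... | zero  | _ rewrite *-zeroʳ (Q * R) | *-zeroʳ R | +-identityʳ b | *-identityʳ ex
                        | *-identityˡ (b ^ ex) | *-identityˡ ((b + R) ^ ex) = tilt Q R s Q≥2 R≥1
  ... | suc zero | _ rewrite *-identityʳ (Q * R) | *-identityʳ R | *-identityʳ ex = begin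
    P ^ D * ((b + R) ^ D * b ^ ex)              ≡⟨ swap (P ^ D) ((b + R) ^ D) (b ^ ex) ⟩
    (b + R) ^ D * (P ^ D * b ^ ex)              ≤⟨ *-monoʳ-≤ ((b + R) ^ D) (tilt Q R s Q≥2 R≥1) ⟩
    (b + R) ^ D * ((Q * b) ^ D * (b + R) ^ ex)  ≡⟨ cong (λ z → (b + R) ^ D * (z * (b + R) ^ ex)) (^-distribʳ-* Q b D) ⟩
    (b + R) ^ D * (Q ^ D * b ^ D * (b + R) ^ ex) ≡⟨ swap₂ ((b + R) ^ D) (Q ^ D) (b ^ D) _ ⟩
    Q ^ D * (b + R) ^ D * (b ^ D * (b + R) ^ ex) ≡⟨ cong (_* (b ^ D * (b + R) ^ ex)) (^-distribʳ-* Q (b + R) D) ⟨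
    (Q * (b + R)) ^ D * (b ^ D * (b + R) ^ ex)  ∎
    where
    open ≤-Reasoning
    D = Q * R
    swap : ∀ x y z → x * (y * z) ≡ y * (x * z)
    swap = solve-∀
    swap₂ : ∀ x q y z → x * (q * y * z) ≡ q * x * (y * z)
    swap₂ = solve-∀
  ... | suc (suc _) | s≤s ()

  h-product : ∀ F n → (P ^ F) ^ (Q * R) * ((b + R) ^ (Q * R * hits F n) * b ^ (ex * len F n))
                    ≤ Π F Q h n ^ (Q * R) * (b ^ (Q * R * hits F n) * (b + R) ^ (ex * len F n))
  h-product F n = begin
    (P ^ F) ^ D * ((b + R) ^ (D * hits F n) * b ^ (ex * len F n))
      ≡⟨ cong₂ _*_ (trans (cong (_^ D) (sym (Π-const Q F P n))) (sym (Π-^ Q F (λ _ → P) D n)))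
           (cong₂ _*_ (pw (b + R) D φ) (pw b ex (onPositive one))) ⟩
    Π F Q (λ _ → P ^ D) n * (Π F Q (λ y → (b + R) ^ (D * φ y)) n * Π F Q (λ y → b ^ (ex * onPositive one y)) n)
      ≡⟨ cong (Π F Q (λ _ → P ^ D) n *_) (sym (Π-* Q F _ _ n)) ⟩
    Π F Q (λ _ → P ^ D) n * Π F Q (λ y → (b + R) ^ (D * φ y) * b ^ (ex * onPositive one y)) n
      ≡⟨ sym (Π-* Q F _ _ n) ⟩
    Π F Q (λ y → P ^ D * ((b + R) ^ (D * φ y) * b ^ (ex * onPositive one y))) n
      ≤⟨ Π-mono Q F h-pointwise n ⟩
    Π F Q (λ y → h y ^ D * (b ^ (D * φ y) * (b + R) ^ (ex * onPositive one y))) n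
      ≡⟨ Π-* Q F _ _ n ⟩
    Π F Q (λ y → h y ^ D) n * Π F Q (λ y → b ^ (D * φ y) * (b + R) ^ (ex * onPositive one y)) n
      ≡⟨ cong (Π F Q (λ y → h y ^ D) n *_) (Π-* Q F _ _ n) ⟩
    Π F Q (λ y → h y ^ D) n * (Π F Q (λ y → b ^ (D * φ y)) n * Π F Q (λ y → (b + R) ^ (ex * onPositive one y)) n)
      ≡⟨ cong₂ _*_ (Π-^ Q F h D n) (cong₂ _*_ (sym (pw b D φ)) (sym (pw (b + R) ex (onPositive one)))) ⟩
    Π F Q h n ^ D * (b ^ (D * hits F n) * (b + R) ^ (ex * len F n)) ∎
    where
    open ≤-Reasoning
    D = Q * R
    φ = onPositive χ%
    pw : ∀ c d ψ → c ^ (d * T F Q ψ n) ≡ Π F Q (λ y → c ^ (d * ψ y)) n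
    pw c d ψ = trans (cong (c ^_) (sym (T-*ˡ Q F d ψ n))) (sym (Π-exp Q F c (λ y → d * ψ y) n))

  P>0 : 0 < P
  P>0 = m≤n+m 1 u

  -- If the weight is at most P^F, multiplying `h-pointwise` over all positions leaves ρ^(QR hits) ≤
  -- ρ^(ex len) with ρ = (b+R)/b > 1, so the exponents compare.
  few-hits : ∀ F n → Π F Q h n ≤ P ^ F → Q * R * hits F n ≤ ex * len F n
  few-hits F n light = ≮⇒≥ λ ℓ<c → <⇒≱ (too-big _ _ ℓ<c) cancelled
    where
    D = Q * R
    PF>0 : 0 < (P ^ F) ^ D
    PF>0 = m^n>0 (P ^ F) {{m^n≢0 P F {{>-nonZero P>0}}}} D
    cancelled : (b + R) ^ (D * hits F n) * b ^ (ex * len F n) ≤ b ^ (D * hits F n) * (b + R) ^ (ex * len F n)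
    cancelled = *-cancelˡ-≤′ ((P ^ F) ^ D) PF>0
      (≤-trans (h-product F n) (*-monoˡ-≤ (b ^ (D * hits F n) * (b + R) ^ (ex * len F n)) (^-monoˡ-≤ D light)))
    b>0 = B>0 Q R s Q≥2 R≥1
    too-big : ∀ l c → l < c → b ^ c * (b + R) ^ l < (b + R) ^ c * b ^ l
    too-big l c l<c = begin-strict
      b ^ c * (b + R) ^ l                          ≡⟨ cong (λ z → b ^ z * (b + R) ^ l) (sym c≡) ⟩
      b ^ (l + j) * (b + R) ^ l                    ≡⟨ cong (_* (b + R) ^ l) (^-distribˡ-+-* b l j) ⟩
      b ^ l * b ^ j * (b + R) ^ l                  ≡⟨ rot (b ^ l) (b ^ j) ((b + R) ^ l) ⟩
      b ^ l * (b + R) ^ l * b ^ j                  <⟨ *-monoʳ-< (b ^ l * (b + R) ^ l) {{>-nonZero positive}}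
                                                        (^-monoˡ-< j {{>-nonZero (m<n⇒0<n∸m l<c)}} (m<m+n b R≥1)) ⟩
      b ^ l * (b + R) ^ l * (b + R) ^ j            ≡⟨ rot₂ (b ^ l) ((b + R) ^ l) ((b + R) ^ j) ⟩
      (b + R) ^ l * (b + R) ^ j * b ^ l            ≡⟨ cong (_* b ^ l) (^-distribˡ-+-* (b + R) l j) ⟨
      (b + R) ^ (l + j) * b ^ l                    ≡⟨ cong (λ z → (b + R) ^ z * b ^ l) c≡ ⟩
      (b + R) ^ c * b ^ l                          ∎
      where
      open ≤-Reasoning
      j = c ∸ l
      c≡ : l + j ≡ c
      c≡ = m+[n∸m]≡n (<⇒≤ l<c)
      positive : 0 < b ^ l * (b + R) ^ l
      positive = *-mono-≤ (m^n>0 b {{>-nonZero b>0}} l)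
                          (m^n>0 (b + R) {{>-nonZero (≤-trans b>0 (m≤m+n b R))}} l)
      rot : ∀ x y z → x * y * z ≡ x * z * y
      rot = solve-∀
      rot₂ : ∀ x y z → x * y * z ≡ y * z * x
      rot₂ = solve-∀

  -- Here n is padded to n digits, enough because n < Qⁿ. Since `h 0` is P, `Π-fuel` shows that any
  -- other sufficient padding gives the same verdict.
  heavy : ℕ → Bool
  heavy n = ⌊ P ^ n <? Π n Q h n ⌋

  heavy-true : ∀ M n → n < Q ^ M → heavy n ≡ true → P ^ M ≤ Π M Q h n
  heavy-true M n n<Q^M hv with P ^ n <? Π n Q h n
  heavy-true M n n<Q^M () | no _
  ... | yes p = *-cancelˡ-≤′ (P ^ n) (m^n>0 P {{>-nonZero P>0}} n) (begin
    P ^ n * P ^ M           ≤⟨ *-monoˡ-≤ (P ^ M) (<⇒≤ p) ⟩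
    Π n Q h n * P ^ M       ≡⟨ Π-fuel Q n M h n (n<b^n Q Q≥2 n) n<Q^M ⟩
    Π M Q h n * P ^ n       ≡⟨ *-comm _ (P ^ n) ⟩
    P ^ n * Π M Q h n       ∎)
    where open ≤-Reasoning

  heavy-false : ∀ F n → n ≤ F → heavy n ≡ false → Π F Q h n ≤ P ^ F
  heavy-false F n n≤F hv with P ^ n <? Π n Q h n
  heavy-false F n n≤F () | yes _
  ... | no ¬p = *-cancelˡ-≤′ (P ^ n) (m^n>0 P {{>-nonZero P>0}} n) (begin
    P ^ n * Π F Q h n       ≡⟨ *-comm (P ^ n) _ ⟩
    Π F Q h n * P ^ n       ≡⟨ Π-fuel Q F n h n (<-≤-trans (n<b^n Q Q≥2 n) (^-monoʳ-≤ Q n≤F)) (n<b^n Q Q≥2 n) ⟩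
    Π n Q h n * P ^ F       ≤⟨ *-monoˡ-≤ (P ^ F) (≮⇒≥ ¬p) ⟩
    P ^ n * P ^ F           ∎)
    where open ≤-Reasoning

  light⇒few-hits : ∀ F n → n ≤ F → heavy n ≡ false → Q * R * hits F n ≤ ex * len F n
  light⇒few-hits F n n≤F hv = few-hits F n (heavy-false F n n≤F hv)

  hits≤len : ∀ F n → hits F n ≤ len F n
  hits≤len F n = T-mono Q F (λ { zero → z≤n ; (suc y) → χ≤1 (suc y % Q) }) n

  S : ℕ → ℕ
  S M = ∑ (Q ^ M) (Π M Q h)

  digit-weights : ∑ Q (λ d → Q * (b + R * χ d)) ≡ Q * u
  digit-weights = trans (∑-*ˡ Q Q _) (cong (Q *_) (trans (∑-+ Q (λ _ → b) _)
    (cong₂ _+_ (∑-const Q b) (∑-*ˡ Q R χ))))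

  atZero : ℕ → ℕ
  atZero zero    = 1
  atZero (suc _) = 0

  -- Only the number 0 departs from the digit formula, its weight being P; the correction term
  -- charges P exactly there.
  h≤ : ∀ x d → d < Q → h (x * Q + d) ≤ Q * (b + R * χ d) + P * (atZero x * atZero d)
  h≤ x d d<Q with x * Q + d in eq | block-% Q x d d<Q
  ... | suc y | r = ≤-trans (≤-reflexive (cong (λ z → Q * (b + R * χ z)) r)) (m≤m+n _ _)
  h≤ x       (suc d) d<Q | zero | _ = contradiction (m+n≡0⇒n≡0 (x * Q) eq) λ ()
  h≤ (suc x) zero    d<Q | zero | _ =
    contradiction (m+n≡0⇒m≡0 Q (m+n≡0⇒m≡0 (suc x * Q) eq)) (≢-nonZero⁻¹ Q)
  h≤ zero    zero    d<Q | zero | _ = ≤-trans (≤-reflexive (sym (*-identityʳ P))) (m≤n+m _ _)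

  ∑-atZero : ∀ n (F : ℕ → ℕ) → ∑ n (λ i → atZero i * F i) ≤ F 0
  ∑-atZero zero    F = z≤n
  ∑-atZero (suc n) F = ≤-reflexive (trans (∑-first n (λ i → atZero i * F i))
    (trans (cong₂ _+_ (+-identityʳ (F 0)) (trans (∑-const n 0) (*-zeroʳ n))) (+-identityʳ (F 0))))

  block-weight : ∀ x → ∑ Q (λ d → h (x * Q + d)) ≤ Q * u + P * atZero x
  block-weight x = begin
    ∑ Q (λ d → h (x * Q + d))                                       ≤⟨ ∑-mono-< Q (h≤ x) ⟩
    ∑ Q (λ d → Q * (b + R * χ d) + P * (atZero x * atZero d))       ≡⟨ ∑-+ Q _ _ ⟩
    ∑ Q (λ d → Q * (b + R * χ d)) + ∑ Q (λ d → P * (atZero x * atZero d))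
      ≡⟨ cong₂ _+_ digit-weights (trans (∑-*ˡ Q P _) (cong (P *_) (∑-cong Q λ d → *-comm (atZero x) _))) ⟩
    Q * u + P * ∑ Q (λ d → atZero d * atZero x)                     ≤⟨ +-monoʳ-≤ (Q * u) (*-monoʳ-≤ P (∑-atZero Q (λ _ → atZero x))) ⟩
    Q * u + P * atZero x                                            ∎
    where open ≤-Reasoning

  -- The last digit is summed first. It yields a factor Qu for every x, except that x = 0 may cost
  -- an extra P, multiplied by the weight P^M of 0.
  S-step : ∀ M → S (suc M) ≤ Q * u * S M + P ^ suc M
  S-step M = begin
    ∑ (Q * Q ^ M) (Π (suc M) Q h)                            ≡⟨ cong (λ z → ∑ z (Π (suc M) Q h)) (*-comm Q _) ⟩
    ∑ (Q ^ M * Q) (Π (suc M) Q h)                            ≡⟨ ∑-blocks (Q ^ M) Q _ ⟩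
    ∑ (Q ^ M) (λ x → ∑ Q (λ d → Π (suc M) Q h (x * Q + d)))  ≤⟨ ∑-mono (Q ^ M) inner ⟩
    ∑ (Q ^ M) (λ x → Q * u * w x + P * (atZero x * w x))     ≡⟨ ∑-+ (Q ^ M) _ _ ⟩
    ∑ (Q ^ M) (λ x → Q * u * w x) + ∑ (Q ^ M) (λ x → P * (atZero x * w x))
      ≡⟨ cong₂ _+_ (∑-*ˡ (Q ^ M) (Q * u) w) (∑-*ˡ (Q ^ M) P _) ⟩
    Q * u * S M + P * ∑ (Q ^ M) (λ x → atZero x * w x)       ≤⟨ +-monoʳ-≤ (Q * u * S M) (*-monoʳ-≤ P (∑-atZero (Q ^ M) w)) ⟩
    Q * u * S M + P * w 0                                    ≡⟨ cong (λ z → Q * u * S M + P * z) (Π-zero Q M h) ⟩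
    Q * u * S M + P ^ suc M                                  ∎
    where
    open ≤-Reasoning
    w = Π M Q h
    inner : ∀ x → ∑ Q (λ d → Π (suc M) Q h (x * Q + d)) ≤ Q * u * w x + P * (atZero x * w x)
    inner x = begin
      ∑ Q (λ d → h (x * Q + d) * w ((x * Q + d) / Q))
        ≡⟨ ∑-cong-< Q (λ d d<Q → trans (cong (λ z → h (x * Q + d) * w z) (divides-block Q x d d<Q)) (*-comm _ (w x))) ⟩
      ∑ Q (λ d → w x * h (x * Q + d))       ≡⟨ ∑-*ˡ Q (w x) _ ⟩
      w x * ∑ Q (λ d → h (x * Q + d))       ≤⟨ *-monoʳ-≤ (w x) (block-weight x) ⟩
      w x * (Q * u + P * atZero x)          ≡⟨ lemma (w x) (Q * u) P (atZero x) ⟩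
      Q * u * w x + P * (atZero x * w x)    ∎
      where
      lemma : ∀ w q p z → w * (q + p * z) ≡ q * w + p * (z * w)
      lemma = solve-∀

  u≥2 : 2 ≤ u
  u≥2 = ≤-trans (*-mono-≤ Q≥2 (B>0 Q R s Q≥2 R≥1)) (m≤m+n (Q * b) (R * s))

  -- The term 3P^M strengthens the induction so that it absorbs the P^(M+1) of `S-step`: 4P ≤ 3Qu,
  -- by Q ≥ 2 and u ≥ 2. The 4 is 1 + 3, the value at M = 0.
  S-bound : ∀ M → S M + 3 * P ^ M ≤ 4 * (Q * u) ^ M
  S-bound zero    = ≤-refl
  S-bound (suc M) = begin
    S (suc M) + 3 * (P * P ^ M)                      ≤⟨ +-monoˡ-≤ _ (S-step M) ⟩
    Q * u * S M + P * P ^ M + 3 * (P * P ^ M)        ≡⟨ lemma₁ (Q * u) (S M) u (P ^ M) ⟩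
    Q * u * S M + (4 * u + 4) * P ^ M                ≤⟨ +-monoʳ-≤ (Q * u * S M) (*-monoˡ-≤ (P ^ M) (begin
       4 * u + 2 * 2       ≤⟨ +-monoʳ-≤ (4 * u) (*-monoʳ-≤ 2 u≥2) ⟩
       4 * u + 2 * u       ≡⟨ lemma₂ u ⟩
       2 * u * 3           ≤⟨ *-monoˡ-≤ 3 (*-monoˡ-≤ u Q≥2) ⟩
       Q * u * 3           ∎)) ⟩
    Q * u * S M + Q * u * 3 * P ^ M                  ≡⟨ lemma₃ (Q * u) (S M) (P ^ M) ⟩
    Q * u * (S M + 3 * P ^ M)                        ≤⟨ *-monoʳ-≤ (Q * u) (S-bound M) ⟩
    Q * u * (4 * (Q * u) ^ M)                        ≡⟨ lemma₄ (Q * u) _ ⟩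
    4 * (Q * u * (Q * u) ^ M)                        ∎
    where
    open ≤-Reasoning
    lemma₁ : ∀ q t u p → q * t + (u + 1) * p + 3 * ((u + 1) * p) ≡ q * t + (4 * u + 4) * p
    lemma₁ = solve-∀
    lemma₂ : ∀ u → 4 * u + 2 * u ≡ 2 * u * 3
    lemma₂ = solve-∀
    lemma₃ : ∀ q t p → q * t + q * 3 * p ≡ q * (t + 3 * p)
    lemma₃ = solve-∀
    lemma₄ : ∀ q x → q * (4 * x) ≡ 4 * (q * x)
    lemma₄ = solve-∀

  -- Each exceptional n < Q^M carries weight at least P^M, and the total weight is at most 4(Qu)^M.
  markov : ∀ M → P ^ M * ∑ (Q ^ M) (bit ∘ heavy) ≤ 4 * (Q * u) ^ M
  markov M = begin
    P ^ M * ∑ (Q ^ M) (bit ∘ heavy)             ≡⟨ ∑-*ˡ (Q ^ M) (P ^ M) _ ⟨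
    ∑ (Q ^ M) (λ n → P ^ M * bit (heavy n))     ≤⟨ ∑-mono-< (Q ^ M) pointwise ⟩
    S M                                         ≤⟨ m≤m+n (S M) _ ⟩
    S M + 3 * P ^ M                             ≤⟨ S-bound M ⟩
    4 * (Q * u) ^ M                             ∎
    where
    open ≤-Reasoning
    pointwise : ∀ n → n < Q ^ M → P ^ M * bit (heavy n) ≤ Π M Q h n
    pointwise n n<Q^M with heavy n in eq
    ... | true  = ≤-trans (≤-reflexive (*-identityʳ (P ^ M))) (heavy-true M n n<Q^M eq)
    ... | false = ≤-trans (≤-reflexive (*-zeroʳ (P ^ M))) z≤n

-- Counting functions and meagerness of the exceptional sets.

⌊⌋-false : ∀ {A : Set} (d : Dec A) → ¬ A → ⌊ d ⌋ ≡ false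
⌊⌋-false (yes a) ¬a = contradiction a ¬a
⌊⌋-false (no _)  ¬a = refl

⌊⌋-cong : ∀ {A B : Set} (d : Dec A) (d′ : Dec B) → (A → B) → (B → A) → ⌊ d ⌋ ≡ ⌊ d′ ⌋
⌊⌋-cong (yes _) (yes _)  f f⁻¹ = refl
⌊⌋-cong (yes a) (no ¬b)  f f⁻¹ = contradiction (f a) ¬b
⌊⌋-cong (no ¬a) (yes b)  f f⁻¹ = contradiction (f⁻¹ b) ¬a
⌊⌋-cong (no _)  (no _)   f f⁻¹ = refl

count≤∑ : ∀ E x → count E x ≤ ∑ (suc x) (bit ∘ E)
count≤∑ E zero    = z≤n
count≤∑ E (suc x) = +-monoˡ-≤ (bit (E (suc x))) (count≤∑ E x)

count≡∑ : ∀ E x → count E x ≡ ∑ x (λ i → bit (E (suc i)))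
count≡∑ E zero    = refl
count≡∑ E (suc x) = cong (_+ bit (E (suc x))) (count≡∑ E x)

enclosing-powers : ∀ Q → 2 ≤ Q → ∀ x → ∃[ M ] (Q ^ M ≤ suc x × suc x < Q ^ suc M)
enclosing-powers Q Q≥2 zero = 0 , ≤-refl , subst (1 <_) (sym (*-identityʳ Q)) Q≥2
enclosing-powers Q Q≥2 (suc x) with enclosing-powers Q Q≥2 x
... | M , lo , hi with suc (suc x) <? Q ^ suc M
...   | yes hi′ = M , m≤n⇒m≤1+n lo , hi′
...   | no ¬hi  = suc M , ≮⇒≥ ¬hi , ≤-<-trans hi (^-monoʳ-< Q Q≥2 (n<1+n (suc M)))

-- A large power β turns the factor T/(QP) < 1 into at most Q⁻². Of the Q^(2M) gained, one Q^M
-- lowers the exponent of x from β to a = β - 1, and the other outgrows the constants.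
exponential-saving⇒meager : ∀ E Q C P T → 2 ≤ Q → 0 < T → T < Q * P →
  (∀ M x → x < Q ^ M → P ^ M * count E x ≤ C * T ^ M) → Meager E
exponential-saving⇒meager E Q C P T Q≥2 T>0 T<QP bound = a , β , ≤-refl , C ^ β * Q ^ a , sparse
  where
  -- By Bernoulli (QP/T)^β ≥ (1 + 1/T)^β ≥ 1 + β/T, which exceeds Q² as soon as β > TQ².
  a = T * (Q * Q)
  β = suc a
  open ≤-Reasoning
  instance
    Q≢0 : NonZero Q
    Q≢0 = >-nonZero (≤-trans (s≤s z≤n) Q≥2)
  P>0 : 0 < P
  P>0 = n≢0⇒n>0 λ { refl → n≮0 (<-≤-trans T<QP (≤-reflexive (*-zeroʳ Q))) }
  saving : T ^ β * (Q * Q) ≤ (Q * P) ^ β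
  saving = *-cancelˡ-≤′ T T>0 (begin
    T * (T ^ β * (Q * Q))         ≡⟨ lemma T (T ^ β) (Q * Q) ⟩
    T ^ β * a                     ≤⟨ *-monoʳ-≤ (T ^ β) (≤-trans (n≤1+n a) (≤-trans (m≤n+m β T) (+-monoʳ-≤ T (m≤m*n β 1)))) ⟩
    T ^ β * (T + β * 1)           ≤⟨ bernoulli T 1 β ⟩
    T * (T + 1) ^ β               ≤⟨ *-monoʳ-≤ T (^-monoˡ-≤ β (subst (_≤ Q * P) (+-comm 1 T) T<QP)) ⟩
    T * (Q * P) ^ β               ∎)
    where
    lemma : ∀ T t q → T * (t * q) ≡ t * (T * q)
    lemma = solve-∀
  pow-swap : ∀ c m n → (c ^ m) ^ n ≡ (c ^ n) ^ m
  pow-swap c m n = trans (^-*-assoc c m n) (trans (cong (c ^_) (*-comm m n)) (sym (^-*-assoc c n m)))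
  raised : ∀ M c → P ^ M * c ≤ C * T ^ M → c ^ β * (Q ^ M * Q ^ M) ≤ C ^ β * (Q ^ β) ^ M
  raised M c p = *-cancelˡ-≤′ ((P ^ M) ^ β) (m^n>0 (P ^ M) {{m^n≢0 P M {{>-nonZero P>0}}}} β) (begin
    (P ^ M) ^ β * (c ^ β * (Q ^ M * Q ^ M))     ≡⟨ *-assoc ((P ^ M) ^ β) (c ^ β) (Q ^ M * Q ^ M) ⟨
    (P ^ M) ^ β * c ^ β * (Q ^ M * Q ^ M)       ≡⟨ cong₂ _*_ (^-distribʳ-* (P ^ M) c β) (^-distribʳ-* Q Q M) ⟨
    (P ^ M * c) ^ β * (Q * Q) ^ M               ≤⟨ *-monoˡ-≤ ((Q * Q) ^ M) (^-monoˡ-≤ β p) ⟩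
    (C * T ^ M) ^ β * (Q * Q) ^ M               ≡⟨ cong (_* (Q * Q) ^ M) (trans (^-distribʳ-* C (T ^ M) β) (cong (C ^ β *_) (pow-swap T M β))) ⟩
    C ^ β * (T ^ β) ^ M * (Q * Q) ^ M           ≡⟨ *-assoc (C ^ β) _ _ ⟩
    C ^ β * ((T ^ β) ^ M * (Q * Q) ^ M)         ≡⟨ cong (C ^ β *_) (^-distribʳ-* (T ^ β) (Q * Q) M) ⟨
    C ^ β * (T ^ β * (Q * Q)) ^ M               ≤⟨ *-monoʳ-≤ (C ^ β) (^-monoˡ-≤ M saving) ⟩
    C ^ β * ((Q * P) ^ β) ^ M                   ≡⟨ cong (λ z → C ^ β * z ^ M) (^-distribʳ-* Q P β) ⟩
    C ^ β * (Q ^ β * P ^ β) ^ M                 ≡⟨ cong (C ^ β *_) (^-distribʳ-* (Q ^ β) (P ^ β) M) ⟩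
    C ^ β * ((Q ^ β) ^ M * (P ^ β) ^ M)         ≡⟨ lemma (C ^ β) ((Q ^ β) ^ M) ((P ^ β) ^ M) ⟩
    (P ^ β) ^ M * (C ^ β * (Q ^ β) ^ M)         ≡⟨ cong (_* (C ^ β * (Q ^ β) ^ M)) (pow-swap P β M) ⟩
    (P ^ M) ^ β * (C ^ β * (Q ^ β) ^ M)         ∎)
    where
    lemma : ∀ c q p → c * (q * p) ≡ p * (c * q)
    lemma = solve-∀
  sparse : ∀ x → C ^ β * Q ^ a < x → count E x ^ β < x ^ a
  sparse (suc x) x₀<x with enclosing-powers Q Q≥2 x
  -- Q^M is at most the argument and N = Q^(M+1) exceeds it. The factor Q^a of the threshold pays
  -- for passing from N^a to (Q^M)^a; the spare N then beats the whole threshold.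
  ... | M , lo , hi = *-cancelˡ-< N _ _ (begin-strict
    N * count E (suc x) ^ β             ≤⟨ *-cancelˡ-≤′ N (m^n>0 Q (suc M)) (begin
       N * (N * c ^ β)                     ≡⟨ lemma₁ N (c ^ β) ⟩
       c ^ β * (N * N)                     ≤⟨ raised (suc M) c (bound (suc M) (suc x) hi) ⟩
       C ^ β * (Q * Q ^ a) ^ suc M         ≡⟨ cong (C ^ β *_) (^-distribʳ-* Q (Q ^ a) (suc M)) ⟩
       C ^ β * (N * (Q ^ a) ^ suc M)       ≡⟨ cong (λ z → C ^ β * (N * (Q ^ a * z))) (pow-swap Q a M) ⟩
       C ^ β * (N * (Q ^ a * (Q ^ M) ^ a)) ≤⟨ *-monoʳ-≤ (C ^ β) (*-monoʳ-≤ N (*-monoʳ-≤ (Q ^ a) (^-monoˡ-≤ a lo))) ⟩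
       C ^ β * (N * (Q ^ a * suc x ^ a))   ≡⟨ lemma₂ (C ^ β) N (Q ^ a) (suc x ^ a) ⟩
       N * (C ^ β * Q ^ a * suc x ^ a)     ∎) ⟩
    C ^ β * Q ^ a * suc x ^ a           <⟨ *-monoˡ-< (suc x ^ a) {{m^n≢0 (suc x) a}} (<-trans x₀<x hi) ⟩
    N * suc x ^ a                       ∎)
    where
    N = Q ^ suc M
    c = count E (suc x)
    lemma₁ : ∀ N c → N * (N * c) ≡ c * (N * N)
    lemma₁ = solve-∀
    lemma₂ : ∀ C N q x → C * (N * (q * x)) ≡ N * (C * q * x)
    lemma₂ = solve-∀

module _ (Q R : ℕ) .{{Q≢0 : NonZero Q}} (Q≥2 : 2 ≤ Q) (R≥1 : 1 ≤ R)
         (χ : ℕ → ℕ) (χ≤1 : ∀ d → χ d ≤ 1) where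
  open Weights Q R Q≥2 R≥1 χ χ≤1

  -- Extending the range to Q^M gⁱ makes it a union of whole fibres of n ↦ ⌊n/gⁱ⌋, each of size gⁱ.
  -- Only the constant in `markov` grows, and the saving Qu < QP is untouched.
  heavy-shift-meager : ∀ g .{{_ : NonZero g}} i → Meager (heavy ∘ shift g i)
  heavy-shift-meager g i = exponential-saving⇒meager _ Q (4 * g ^ i) P (Q * u) Q≥2
    (*-mono-≤ (≤-trans (s≤s z≤n) Q≥2) (≤-trans (s≤s z≤n) u≥2)) (*-monoʳ-< Q (m<m+n u (s≤s z≤n))) bound
    where
    open ≤-Reasoning
    bound : ∀ M x → x < Q ^ M → P ^ M * count (heavy ∘ shift g i) x ≤ 4 * g ^ i * (Q * u) ^ M
    bound M x x<Q^M = begin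
      P ^ M * count (heavy ∘ shift g i) x                 ≤⟨ *-monoʳ-≤ (P ^ M) (count≤∑ _ x) ⟩
      P ^ M * ∑ (suc x) (bit ∘ heavy ∘ shift g i)         ≤⟨ *-monoʳ-≤ (P ^ M) (∑-extend _ (≤-trans x<Q^M (m≤m*n (Q ^ M) (g ^ i) {{m^n≢0 g i}}))) ⟩
      P ^ M * ∑ (Q ^ M * g ^ i) (bit ∘ heavy ∘ shift g i) ≡⟨ cong (P ^ M *_) (∑-shift g (Q ^ M) i (bit ∘ heavy)) ⟩
      P ^ M * (g ^ i * ∑ (Q ^ M) (bit ∘ heavy))           ≡⟨ lemma (P ^ M) (g ^ i) _ ⟩
      g ^ i * (P ^ M * ∑ (Q ^ M) (bit ∘ heavy))           ≤⟨ *-monoʳ-≤ (g ^ i) (markov M) ⟩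
      g ^ i * (4 * (Q * u) ^ M)                           ≡⟨ lemma′ (g ^ i) _ ⟩
      4 * g ^ i * (Q * u) ^ M                             ∎
      where
      lemma : ∀ p g s → p * (g * s) ≡ g * (p * s)
      lemma = solve-∀
      lemma′ : ∀ g s → g * (4 * s) ≡ 4 * g * s
      lemma′ = solve-∀

-- Digit strings, windows and their values.

nth-++ˡ : ∀ p xs ys → p < length xs → nth p (xs ++ ys) ≡ nth p xs
nth-++ˡ zero    (x ∷ xs) ys p<         = refl
nth-++ˡ (suc p) (x ∷ xs) ys (s≤s p<)   = nth-++ˡ p xs ys p<

nth-< : ∀ g p xs → 0 < g → All (_< g) xs → nth p xs < g
nth-< g p       []       g>0 _        = g>0
nth-< g zero    (x ∷ xs) g>0 (q ∷ _)  = q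
nth-< g (suc p) (x ∷ xs) g>0 (_ ∷ qs) = nth-< g p xs g>0 qs

module Base (g-1 : ℕ) where

  g : ℕ
  g = suc g-1

  digits-< : ∀ F n → All (_< g) (digitsFuel F g n)
  digits-< zero    n       = []
  digits-< (suc F) zero    = []
  digits-< (suc F) (suc n) = All-++⁺ (digits-< F (suc n / g)) (m%n<n (suc n) g ∷ [])

  length-digits : ∀ F n → length (digitsFuel F g n) ≡ T F g (onPositive one) n
  length-digits zero    n       = refl
  length-digits (suc F) zero    = sym (T-zero g F (onPositive one) refl)
  length-digits (suc F) (suc n) = trans (length-++ (digitsFuel F g (suc n / g)))
    (trans (+-comm _ 1) (cong suc (length-digits F (suc n / g))))

  -- Reading the digits xs after the digits of v.
  stateL : ℕ → List ℕ → ℕ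
  stateL v []       = v
  stateL v (x ∷ xs) = stateL (v * g + x) xs

  hitsL : (ℕ → ℕ) → ℕ → List ℕ → ℕ
  hitsL ψ v []       = 0
  hitsL ψ v (x ∷ xs) = ψ (v * g + x) + hitsL ψ (v * g + x) xs

  stateL-++ : ∀ v xs ys → stateL v (xs ++ ys) ≡ stateL (stateL v xs) ys
  stateL-++ v []       ys = refl
  stateL-++ v (x ∷ xs) ys = stateL-++ (v * g + x) xs ys

  hitsL-++ : ∀ ψ v xs ys → hitsL ψ v (xs ++ ys) ≡ hitsL ψ v xs + hitsL ψ (stateL v xs) ys
  hitsL-++ ψ v []       ys = refl
  hitsL-++ ψ v (x ∷ xs) ys = trans (cong (ψ (v * g + x) +_) (hitsL-++ ψ (v * g + x) xs ys))
    (sym (+-assoc (ψ (v * g + x)) _ _))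

  module _ (g≥2 : 2 ≤ g) where

    quotient≤ : ∀ F n → suc n ≤ suc F → suc n / g ≤ F
    quotient≤ F n (s≤s n≤F) = ≤-trans (s≤s⁻¹ (m/n<m (suc n) g g≥2)) n≤F

    stateL-digits : ∀ F n v → n ≤ F → stateL v (digitsFuel F g n) ≡ v * g ^ length (digitsFuel F g n) + n
    stateL-digits zero    zero    v n≤F = trans (sym (*-identityʳ v)) (sym (+-identityʳ _))
    stateL-digits (suc F) zero    v n≤F = trans (sym (*-identityʳ v)) (sym (+-identityʳ _))
    stateL-digits (suc F) (suc n) v n≤F = begin-equality
      stateL v (ds ++ [ r ])                  ≡⟨ stateL-++ v ds [ r ] ⟩
      stateL v ds * g + r                     ≡⟨ cong (λ z → z * g + r) (stateL-digits F q v (quotient≤ F n n≤F)) ⟩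
      (v * g ^ length ds + q) * g + r         ≡⟨ lemma v (g ^ length ds) q g r ⟩
      v * (g * g ^ length ds) + (r + q * g)   ≡⟨ cong₂ (λ z y → v * g ^ z + y) (trans (+-comm 1 (length ds)) (sym (length-++ ds))) (sym (m≡m%n+[m/n]*n (suc n) g)) ⟩
      v * g ^ length (ds ++ [ r ]) + suc n    ∎
      where
      open ≤-Reasoning
      q = suc n / g
      r = suc n % g
      ds = digitsFuel F g q
      lemma : ∀ v G q g r → (v * G + q) * g + r ≡ v * (g * G) + (r + q * g)
      lemma = solve-∀

    module _ (k Q : ℕ) .{{_ : NonZero Q}} (Q≡ : Q ≡ g ^ k) (χ : ℕ → ℕ) (χ≤1 : ∀ d → χ d ≤ 1) where

      private
        ψ : ℕ → ℕ
        ψ y = χ (y % Q)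

      forget-prefix : ∀ l v n → k ≤ l → (v * g ^ l + n) % Q ≡ n % Q
      forget-prefix l v n k≤l = trans (cong (_% Q) (trans (+-comm _ n) (cong (n +_) multiple)))
        ([m+kn]%n≡m%n n (v * g ^ (l ∸ k)) Q)
        where
        multiple : v * g ^ l ≡ v * g ^ (l ∸ k) * Q
        multiple = trans (cong (v *_) (trans (cong (g ^_) (sym (m∸n+n≡m k≤l)))
          (trans (^-distribˡ-+-* g (l ∸ k) k) (cong (g ^ (l ∸ k) *_) (sym Q≡))))) (sym (*-assoc v _ Q))

      -- Only the first k − 1 windows ending in this block depend on the preceding digits v.
      hitsL-digits : ∀ F n v → n ≤ F →
        hitsL ψ v (digitsFuel F g n) ≤ T F g (onPositive ψ) n + k ⊓ length (digitsFuel F g n)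
      hitsL-digits zero    n       v n≤F = z≤n
      hitsL-digits (suc F) zero    v n≤F = z≤n
      hitsL-digits (suc F) (suc n) v n≤F = begin
        hitsL ψ v (ds ++ [ r ])                                ≡⟨ hitsL-++ ψ v ds [ r ] ⟩
        hitsL ψ v ds + (ψ last + 0)                            ≤⟨ +-monoˡ-≤ (ψ last + 0) (hitsL-digits F q v q≤F) ⟩
        T F g (onPositive ψ) q + k ⊓ length ds + (ψ last + 0)  ≤⟨ final ⟩
        ψ (suc n) + T F g (onPositive ψ) q + k ⊓ suc (length ds)
          ≡⟨ cong (λ z → ψ (suc n) + T F g (onPositive ψ) q + k ⊓ z) (trans (+-comm 1 _) (sym (length-++ ds))) ⟩
        ψ (suc n) + T F g (onPositive ψ) q + k ⊓ length (ds ++ [ r ]) ∎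
        where
        open ≤-Reasoning
        q = suc n / g
        r = suc n % g
        q≤F = quotient≤ F n n≤F
        ds = digitsFuel F g q
        last = stateL v ds * g + r
        last≡ : last ≡ v * g ^ suc (length ds) + suc n
        last≡ = trans (sym (stateL-++ v ds [ r ])) (trans (stateL-digits (suc F) (suc n) v n≤F)
          (cong (λ z → v * g ^ z + suc n) (trans (length-++ ds) (+-comm _ 1))))
        lemma₁ : ∀ t c p → t + c + (p + 0) ≡ p + t + c
        lemma₁ = solve-∀
        lemma₂ : ∀ t c → t + c + 1 ≡ t + suc c
        lemma₂ = solve-∀
        final : T F g (onPositive ψ) q + k ⊓ length ds + (ψ last + 0)
              ≤ ψ (suc n) + T F g (onPositive ψ) q + k ⊓ suc (length ds)
        -- While fewer than k digits precede, the window may reach into v, and the growth of `k ⊓ _`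
        -- pays for it. Afterwards the minimum is constant and both windows agree modulo Q.
        final with k ≤? length ds
        ... | yes k≤ = begin
          t + k ⊓ length ds + (ψ last + 0)       ≡⟨ cong (λ z → t + k ⊓ length ds + (z + 0)) (cong χ (trans (cong (_% Q) last≡) (forget-prefix _ v (suc n) (m≤n⇒m≤1+n k≤)))) ⟩
          t + k ⊓ length ds + (ψ (suc n) + 0)    ≡⟨ lemma₁ t (k ⊓ length ds) (ψ (suc n)) ⟩
          ψ (suc n) + t + k ⊓ length ds          ≤⟨ +-monoʳ-≤ (ψ (suc n) + t) (⊓-monoʳ-≤ k (n≤1+n (length ds))) ⟩
          ψ (suc n) + t + k ⊓ suc (length ds)    ∎
          where t = T F g (onPositive ψ) q
        ... | no k≰ = begin
          t + k ⊓ length ds + (ψ last + 0)       ≤⟨ +-monoʳ-≤ (t + k ⊓ length ds) (≤-trans (≤-reflexive (+-identityʳ _)) (χ≤1 _)) ⟩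
          t + k ⊓ length ds + 1                  ≡⟨ cong (λ z → t + z + 1) (m≥n⇒m⊓n≡n (<⇒≤ (≰⇒> k≰))) ⟩
          t + length ds + 1                      ≡⟨ lemma₂ t (length ds) ⟩
          t + suc (length ds)                    ≡⟨ cong (t +_) (m≥n⇒m⊓n≡n (≰⇒> k≰)) ⟨
          t + k ⊓ suc (length ds)                ≤⟨ +-monoˡ-≤ (k ⊓ suc (length ds)) (m≤n+m t (ψ (suc n))) ⟩
          ψ (suc n) + t + k ⊓ suc (length ds)    ∎
          where t = T F g (onPositive ψ) q

  state : (ℕ → ℕ) → ℕ → ℕ
  state a zero    = 0
  state a (suc e) = state a e * g + a e

  ∑-state : ∀ ψ a xs o → (∀ p → p < length xs → a (o + p) ≡ nth p xs) →
    ∑ (o + length xs) (λ e → ψ (state a (suc e))) ≡ ∑ o (λ e → ψ (state a (suc e))) + hitsL ψ (state a o) xs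
  ∑-state ψ a []       o agree = trans (cong (λ z → ∑ z (λ e → ψ (state a (suc e)))) (+-identityʳ o)) (sym (+-identityʳ _))
  ∑-state ψ a (x ∷ xs) o agree rewrite +-suc o (length xs) =
    trans (∑-state ψ a xs (suc o) λ p p< → trans (cong a (sym (+-suc o p))) (agree (suc p) (s≤s p<)))
    (trans (+-assoc (∑ o (λ e → ψ (state a (suc e)))) _ _)
      (cong (∑ o (λ e → ψ (state a (suc e))) +_) (cong (λ z → ψ (state a o * g + z) + hitsL ψ (state a o * g + z) xs) a≡x)))
    where
    a≡x : a o ≡ x
    a≡x = trans (cong a (sym (+-identityʳ o))) (agree 0 (s≤s z≤n))

  window : (ℕ → ℕ) → ℕ → ℕ → ℕ
  window a zero    i = 0
  window a (suc k) i = a i * g ^ k + window a k (suc i)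

  state-window : ∀ a k i → state a (k + i) ≡ state a i * g ^ k + window a k i
  state-window a zero    i = trans (sym (*-identityʳ _)) (sym (+-identityʳ _))
  state-window a (suc k) i = begin-equality
    state a (suc k + i)                                    ≡⟨ cong (state a) (sym (+-suc k i)) ⟩
    state a (k + suc i)                                    ≡⟨ state-window a k (suc i) ⟩
    (state a i * g + a i) * g ^ k + window a k (suc i)     ≡⟨ lemma (state a i) g (a i) (g ^ k) _ ⟩
    state a i * (g * g ^ k) + (a i * g ^ k + window a k (suc i)) ∎
    where
    open ≤-Reasoning
    lemma : ∀ s g x G w → (s * g + x) * G + w ≡ s * (g * G) + (x * G + w)
    lemma = solve-∀

  value : List ℕ → ℕ
  value []       = 0
  value (x ∷ xs) = x * g ^ length xs + value xs

  mixed-radix-< : ∀ {x v} G → x < g → v < G → x * G + v < g * G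
  mixed-radix-< {x} {v} G x<g v<G = begin-strict
    x * G + v   <⟨ +-monoʳ-< (x * G) v<G ⟩
    x * G + G   ≡⟨ +-comm _ G ⟩
    suc x * G   ≤⟨ *-monoˡ-≤ G x<g ⟩
    g * G       ∎
    where open ≤-Reasoning

  value-< : ∀ xs → All (_< g) xs → value xs < g ^ length xs
  value-< []       []       = s≤s z≤n
  value-< (x ∷ xs) (p ∷ ps) = mixed-radix-< _ p (value-< xs ps)

  module _ (a : ℕ → ℕ) (a<g : ∀ i → a i < g) where

    window-< : ∀ k i → window a k i < g ^ k
    window-< zero    i = s≤s z≤n
    window-< (suc k) i = mixed-radix-< _ (a<g i) (window-< k (suc i))

    -- The k digits from position i on are the last k of the first k + i digits. This passes from
    -- windows indexed by their start to truncations indexed by their end.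
    state-%-window : ∀ k Q .{{_ : NonZero Q}} → Q ≡ g ^ k → ∀ i → state a (k + i) % Q ≡ window a k i
    state-%-window k Q Q≡ i = trans (cong (_% Q) (trans (state-window a k i) (cong (λ z → state a i * z + window a k i) (sym Q≡))))
      (block-% Q (state a i) _ (subst (window a k i <_) (sym Q≡) (window-< k i)))

    -- All digits are below g, so base-g representations of fixed length are unique: division by
    -- g^(length xs) recovers the leading digit.
    occursAt-window : ∀ xs → All (_< g) xs → ∀ i → occursAt a xs i ≡ ⌊ window a (length xs) i ≟ value xs ⌋
    occursAt-window []       []       i = refl
    occursAt-window (x ∷ xs) (p ∷ ps) i with a i ≟ x
    ... | yes refl = trans (occursAt-window xs ps (suc i))
      (⌊⌋-cong (_ ≟ _) (_ ≟ _) (cong (a i * g ^ length xs +_)) (+-cancelˡ-≡ (a i * g ^ length xs) _ _))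
    ... | no a≢x = sym (⌊⌋-false (_ ≟ _) (a≢x ∘ quotients))
      where
      G = g ^ length xs
      instance
        G≢0 : NonZero G
        G≢0 = m^n≢0 g (length xs)
      quotients : a i * G + window a (length xs) (suc i) ≡ x * G + value xs → a i ≡ x
      quotients eq = trans (sym (divides-block G (a i) _ (window-< (length xs) (suc i))))
        (trans (cong (_/ G) eq) (divides-block G x _ (value-< xs ps)))

-- Block lengths, growth and the size of the error terms.

uniform-threshold : (A : ℕ → ℕ → Set) → (∀ i → ∃[ x₀ ] (∀ x → x₀ ≤ x → A i x)) →
                    ∀ k → ∃[ x₀ ] (∀ i → i < k → ∀ x → x₀ ≤ x → A i x)
uniform-threshold A ev zero    = 0 , λ i ()
uniform-threshold A ev (suc k) with uniform-threshold A ev k | ev k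
... | X , p | x₀ , q = X ⊔ x₀ , r
  where
  r : ∀ i → i < suc k → ∀ x → X ⊔ x₀ ≤ x → A i x
  r i i<1+k x X≤x with m≤n⇒m<n∨m≡n (s≤s⁻¹ i<1+k)
  ... | inj₁ i<k  = p i i<k x (≤-trans (m≤m⊔n X x₀) X≤x)
  ... | inj₂ refl = q x (≤-trans (m≤n⊔m X x₀) X≤x)

module Concatenation (g-1 : ℕ) (g≥2 : 2 ≤ suc g-1) (f : ℕ → ℕ) (f≥1 : ∀ m → 1 ≤ m → 1 ≤ f m) where

  open Base g-1

  ℓ : ℕ → ℕ
  ℓ n = T n g (onPositive one) n

  <g^ℓ : ∀ F n → n ≤ F → n < g ^ T F g (onPositive one) n
  <g^ℓ zero    zero    n≤F = s≤s z≤n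
  <g^ℓ (suc F) zero    n≤F = m^n>0 g (T F g (onPositive one) (0 / g))
  <g^ℓ (suc F) (suc n) n≤F = begin-strict
    suc n                       ≡⟨ trans (m≡m%n+[m/n]*n (suc n) g) (+-comm (suc n % g) _) ⟩
    suc n / g * g + suc n % g   <⟨ +-monoʳ-< (suc n / g * g) (m%n<n (suc n) g) ⟩
    suc n / g * g + g           ≡⟨ lemma (suc n / g) g ⟩
    g * suc (suc n / g)         ≤⟨ *-monoʳ-≤ g (<g^ℓ F (suc n / g) (quotient≤ g≥2 F n n≤F)) ⟩
    g * g ^ T F g (onPositive one) (suc n / g) ∎
    where
    open ≤-Reasoning
    lemma : ∀ q g → q * g + g ≡ g * suc q
    lemma = solve-∀

  ℓ≤ : ∀ F n j → n < g ^ j → T F g (onPositive one) n ≤ j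
  ℓ≤ zero    n       j       n<g^j = z≤n
  ℓ≤ (suc F) zero    j       n<g^j = ≤-trans (≤-reflexive (T-zero g (suc F) (onPositive one) refl)) z≤n
  ℓ≤ (suc F) (suc n) zero    (s≤s ())
  ℓ≤ (suc F) (suc n) (suc j) n<g^j = s≤s (ℓ≤ F (suc n / g) j (quotient<^ g j (suc n) n<g^j))

  n<g^ℓ[n] : ∀ n → n < g ^ ℓ n
  n<g^ℓ[n] n = <g^ℓ n n ≤-refl

  ℓ-≤ : ∀ n j → n < g ^ j → ℓ n ≤ j
  ℓ-≤ n = ℓ≤ n n

  ℓ-pos : ∀ n → 1 ≤ n → 1 ≤ ℓ n
  ℓ-pos (suc n) _ = s≤s z≤n

  g^pred-ℓ≤ : ∀ n v → ℓ n ≡ suc v → g ^ v ≤ n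
  g^pred-ℓ≤ n v ℓ≡ = ≮⇒≥ λ n<g^v → 1+n≰n (subst (_≤ v) ℓ≡ (ℓ-≤ n v n<g^v))

  length-digits≡ℓ : ∀ n → length (digits g n) ≡ ℓ n
  length-digits≡ℓ n = length-digits n n

  prefix : ℕ → List ℕ
  prefix = prefixDigits g f

  L : ℕ → ℕ
  L y = length (prefix y)

  L-suc : ∀ y → L (suc y) ≡ L y + ℓ (f (suc y))
  L-suc y = trans (length-++ (prefix y)) (cong (L y +_) (length-digits≡ℓ (f (suc y))))

  L≡∑ : ∀ y → L y ≡ ∑ y (λ m → ℓ (f (suc m)))
  L≡∑ zero    = refl
  L≡∑ (suc y) = trans (L-suc y) (cong (_+ ℓ (f (suc y))) (L≡∑ y))

  L-< : ∀ y → L y < L (suc y)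
  L-< y = subst (L y <_) (sym (L-suc y)) (m<m+n (L y) (ℓ-pos _ (f≥1 (suc y) (s≤s z≤n))))

  y≤L : ∀ y → y ≤ L y
  y≤L zero    = z≤n
  y≤L (suc y) = ≤-<-trans (y≤L y) (L-< y)

  L-mono : ∀ {y z} → y ≤ z → L y ≤ L z
  L-mono {y} {z} y≤z = subst (λ w → L y ≤ L w) (m∸n+n≡m y≤z) (go (z ∸ y))
    where
    go : ∀ j → L y ≤ L (j + y)
    go zero    = ≤-refl
    go (suc j) = ≤-trans (go j) (<⇒≤ (L-< (j + y)))

  enclosing-blocks : ∀ N → ∃[ y ] (L y ≤ N × N < L (suc y))
  enclosing-blocks zero    = 0 , z≤n , L-< 0
  enclosing-blocks (suc N) with enclosing-blocks N
  ... | y , lo , hi with suc N <? L (suc y)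
  ...   | yes hi′ = y , m≤n⇒m≤1+n lo , hi′
  ...   | no ¬hi  = suc y , ≮⇒≥ ¬hi , ≤-<-trans hi (L-< (suc y))

  α : ℕ → ℕ
  α = alphaDigit g f

  prefix-< : ∀ y → All (_< g) (prefix y)
  prefix-< zero    = []
  prefix-< (suc y) = All-++⁺ (prefix-< y) (digits-< (f (suc y)) (f (suc y)))

  α<g : ∀ p → α p < g
  α<g p = nth-< g p (prefix (suc p)) (s≤s z≤n) (prefix-< (suc p))

  nth-prefix : ∀ j y p → p < L y → nth p (prefix (j + y)) ≡ nth p (prefix y)
  nth-prefix zero    y p p< = refl
  nth-prefix (suc j) y p p< = trans (nth-++ˡ p (prefix (j + y)) _ (<-≤-trans p< (L-mono (m≤n+m y j)))) (nth-prefix j y p p<)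

  α≡nth : ∀ y p → p < L y → α p ≡ nth p (prefix y)
  α≡nth y p p< = trans (sym (nth-prefix y (suc p) p (y≤L (suc p))))
    (trans (cong (nth p ∘ prefix) (+-comm y (suc p))) (nth-prefix (suc p) y p p<))

  module _ (K : ℕ) (K≥1 : 1 ≤ K) (f≤ : ∀ m → 1 ≤ m → f m ≤ (m + 2) ^ K)
           (q : ℕ) (q≥1 : 1 ≤ q) (x₁ : ℕ) (growth : ∀ n → x₁ < n → n ^ n ≤ prod3 f n ^ q) where

    -- A common bound for the lengths of the first y + 1 blocks, including the one cut by the
    -- endpoint: f(m+1) ≤ (m+3)^K for m ≤ y.
    W : ℕ → ℕ
    W y = K * ℓ (y + 3)

    ℓ[f]≤W : ∀ m y → m ≤ y → ℓ (f (suc m)) ≤ W y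
    ℓ[f]≤W m y m≤y = ℓ-≤ (f (suc m)) (W y) (begin-strict
      f (suc m)                       ≤⟨ f≤ (suc m) (s≤s z≤n) ⟩
      (suc m + 2) ^ K                 ≡⟨ cong (_^ K) (lemma m) ⟩
      (m + 3) ^ K                     ≤⟨ ^-monoˡ-≤ K (+-monoˡ-≤ 3 m≤y) ⟩
      (y + 3) ^ K                     <⟨ ^-monoˡ-< K {{>-nonZero K≥1}} (n<g^ℓ[n] (y + 3)) ⟩
      (g ^ ℓ (y + 3)) ^ K             ≡⟨ trans (^-*-assoc g (ℓ (y + 3)) K) (cong (g ^_) (*-comm (ℓ (y + 3)) K)) ⟩
      g ^ (K * ℓ (y + 3))             ∎)
      where
      open ≤-Reasoning
      lemma : ∀ m → suc m + 2 ≡ m + 3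
      lemma = solve-∀

    -- Two spare digits per factor accommodate the truncation at 3, since 3 ≤ g².
    prod3≤ : ∀ y → prod3 f y ≤ g ^ (L y + 2 * y)
    prod3≤ zero    = s≤s z≤n
    prod3≤ (suc y) = begin
      prod3 f y * (3 ⊔ f (suc y))                 ≤⟨ *-mono-≤ (prod3≤ y) (⊔-lub three≤ f≤g) ⟩
      g ^ (L y + 2 * y) * g ^ (ℓ (f (suc y)) + 2) ≡⟨ ^-distribˡ-+-* g (L y + 2 * y) (ℓ (f (suc y)) + 2) ⟨
      g ^ (L y + 2 * y + (ℓ (f (suc y)) + 2))     ≡⟨ cong (g ^_) (lemma (L y) y (ℓ (f (suc y)))) ⟩
      g ^ (L y + ℓ (f (suc y)) + 2 * suc y)       ≡⟨ cong (λ z → g ^ (z + 2 * suc y)) (L-suc y) ⟨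
      g ^ (L (suc y) + 2 * suc y)                 ∎
      where
      open ≤-Reasoning
      lemma : ∀ l y m → l + 2 * y + (m + 2) ≡ l + m + 2 * suc y
      lemma = solve-∀
      three≤ : 3 ≤ g ^ (ℓ (f (suc y)) + 2)
      three≤ = ≤-trans (n≤1+n 3) (≤-trans (^-monoˡ-≤ 2 g≥2) (^-monoʳ-≤ g (m≤n+m 2 (ℓ (f (suc y))))))
      f≤g : f (suc y) ≤ g ^ (ℓ (f (suc y)) + 2)
      f≤g = ≤-trans (<⇒≤ (n<g^ℓ[n] (f (suc y)))) (^-monoʳ-≤ g (m≤m+n (ℓ (f (suc y))) 2))

    -- Since g^(ℓ(y)-1) ≤ y, the growth hypothesis bounds g^(y(ℓ(y)-1)) by `prod3 f y ^ q`, and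
    -- exponents of g can be compared. Up to O(y), the first y blocks have at least yℓ(y)/q digits.
    y*ℓ≤L : ∀ y → x₁ < y → y * ℓ y ≤ q * L y + (2 * q + 1) * y
    y*ℓ≤L y x₁<y with ℓ y in eq
    ... | zero  = ≤-trans (≤-reflexive (*-zeroʳ y)) z≤n
    ... | suc v = begin
      y * suc v                         ≡⟨ *-suc y v ⟩
      y + y * v                         ≤⟨ +-monoʳ-≤ y (^-cancelʳ-≤ g g≥2 powers) ⟩
      y + (L y + 2 * y) * q             ≡⟨ lemma y (L y) q ⟩
      q * L y + (2 * q + 1) * y         ∎
      where
      open ≤-Reasoning
      lemma : ∀ y l q → y + (l + 2 * y) * q ≡ q * l + (2 * q + 1) * y
      lemma = solve-∀
      powers : g ^ (y * v) ≤ g ^ ((L y + 2 * y) * q)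
      powers = begin
        g ^ (y * v)                   ≡⟨ trans (cong (g ^_) (*-comm y v)) (sym (^-*-assoc g v y)) ⟩
        (g ^ v) ^ y                   ≤⟨ ^-monoˡ-≤ y (g^pred-ℓ≤ y v eq) ⟩
        y ^ y                         ≤⟨ growth y x₁<y ⟩
        prod3 f y ^ q                 ≤⟨ ^-monoˡ-≤ q (prod3≤ y) ⟩
        (g ^ (L y + 2 * y)) ^ q       ≡⟨ ^-*-assoc g (L y + 2 * y) q ⟩
        g ^ ((L y + 2 * y) * q)       ∎

    ℓ[y+3]≤2ℓ : ∀ y → 3 ≤ y → ℓ (y + 3) ≤ 2 * ℓ y
    ℓ[y+3]≤2ℓ y y≥3 = begin
      ℓ (y + 3)       ≤⟨ ℓ-≤ (y + 3) (suc (ℓ y)) (begin-strict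
         y + 3               ≤⟨ +-monoʳ-≤ y y≥3 ⟩
         y + y               ≡⟨ cong (y +_) (sym (+-identityʳ y)) ⟩
         2 * y               ≤⟨ *-monoˡ-≤ y g≥2 ⟩
         g * y               <⟨ *-monoʳ-< g (n<g^ℓ[n] y) ⟩
         g * g ^ ℓ y         ∎) ⟩
      1 + ℓ y         ≤⟨ +-monoˡ-≤ (ℓ y) (ℓ-pos y (≤-trans (s≤s z≤n) y≥3)) ⟩
      ℓ y + ℓ y       ≡⟨ cong (ℓ y +_) (sym (+-identityʳ _)) ⟩
      2 * ℓ y         ∎
      where open ≤-Reasoning

    -- β y is the number of exceptional blocks among the first y.
    error-negligible : ∀ k R (β : ℕ → ℕ) →
      (∀ r → 1 ≤ r → ∃[ y₀ ] (∀ y → y₀ ≤ y → r * β y ≤ y)) →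
      ∃[ y₀ ] (∀ y → y₀ ≤ y → R * (k * (1 + y) + (1 + β y) * W y) ≤ L y)
    error-negligible k R β β-small = y₀ , bound
      where
      -- The target is multiplied by 4q. A factor 2 comes from ℓ(y+3) ≤ 2ℓ(y), and another because c
      -- ≤ y and cβ(y) ≤ y together give 2y.
      c = 16 * q * R * K
      -- Once ℓ(y) ≥ v₀, the first summand makes the linear loss in `y*ℓ≤L` at most half of yℓ(y),
      -- and the second covers the k windows charged to each block.
      v₀ = 2 * (2 * q + 1) + 8 * q * R * k
      -- The successor keeps the tolerance positive even when c = 0.
      small = β-small (suc c) (s≤s z≤n)
      y₀ = proj₁ small + suc x₁ + c + 3 + g ^ v₀
      bound : ∀ y → y₀ ≤ y → R * (k * (1 + y) + (1 + β y) * W y) ≤ L y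
      bound y y₀≤y = *-cancelˡ-≤′ (4 * q) (*-mono-≤ (s≤s (z≤n {3})) q≥1) (begin
        4 * q * (R * (k * (1 + y) + (1 + β y) * W y))
          ≡⟨ lemma₁ q R k y (β y) (W y) ⟩
        4 * q * R * k * (1 + y) + 4 * q * R * ((1 + β y) * W y)
          ≤⟨ +-mono-≤ crossing blocks ⟩
        y * ℓ y + y * ℓ y               ≡⟨ lemma₂ (y * ℓ y) ⟩
        2 * (y * ℓ y)                   ≤⟨ *-monoʳ-≤ 2 yℓ≤ ⟩
        2 * (2 * q * L y)               ≡⟨ lemma₃ q (L y) ⟩
        4 * q * L y                     ∎)
        where
        open ≤-Reasoning
        lemma₁ : ∀ q R k y b w → 4 * q * (R * (k * (1 + y) + (1 + b) * w)) ≡ 4 * q * R * k * (1 + y) + 4 * q * R * ((1 + b) * w)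
        lemma₁ = solve-∀
        lemma₂ : ∀ x → x + x ≡ 2 * x
        lemma₂ = solve-∀
        lemma₃ : ∀ q l → 2 * (2 * q * l) ≡ 4 * q * l
        lemma₃ = solve-∀
        y₀-g = proj₁ small + suc x₁ + c + 3
        y₀-3 = proj₁ small + suc x₁ + c
        ≥3+ : y₀-g ≤ y
        ≥3+ = ≤-trans (m≤m+n y₀-g (g ^ v₀)) y₀≤y
        ≥c+ : y₀-3 ≤ y
        ≥c+ = ≤-trans (m≤m+n y₀-3 3) ≥3+
        y≥3 : 3 ≤ y
        y≥3 = ≤-trans (m≤n+m 3 y₀-3) ≥3+
        c≤y : c ≤ y
        c≤y = ≤-trans (m≤n+m c (proj₁ small + suc x₁)) ≥c+
        ≥x₁+ : proj₁ small + suc x₁ ≤ y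
        ≥x₁+ = ≤-trans (m≤m+n (proj₁ small + suc x₁) c) ≥c+
        x₁<y : x₁ < y
        x₁<y = ≤-trans (m≤n+m (suc x₁) (proj₁ small)) ≥x₁+
        cβ≤y : c * β y ≤ y
        cβ≤y = ≤-trans (m≤n+m (c * β y) (β y)) (proj₂ small y (≤-trans (m≤m+n (proj₁ small) (suc x₁)) ≥x₁+))
        v₀≤ℓ : v₀ ≤ ℓ y
        v₀≤ℓ = ^-cancelʳ-≤ g g≥2 (≤-trans (≤-trans (m≤n+m (g ^ v₀) y₀-g) y₀≤y) (<⇒≤ (n<g^ℓ[n] y)))
        yℓ≤ : y * ℓ y ≤ 2 * q * L y
        yℓ≤ = +-cancelʳ-≤ (y * ℓ y) _ _ (begin
          y * ℓ y + y * ℓ y                       ≡⟨ lemma₂ (y * ℓ y) ⟩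
          2 * (y * ℓ y)                           ≤⟨ *-monoʳ-≤ 2 (y*ℓ≤L y x₁<y) ⟩
          2 * (q * L y + (2 * q + 1) * y)         ≡⟨ lemma₄ q (L y) y ⟩
          2 * q * L y + y * (2 * (2 * q + 1))     ≤⟨ +-monoʳ-≤ (2 * q * L y) (*-monoʳ-≤ y (≤-trans (m≤m+n _ (8 * q * R * k)) v₀≤ℓ)) ⟩
          2 * q * L y + y * ℓ y                   ∎)
          where
          lemma₄ : ∀ q l y → 2 * (q * l + (2 * q + 1) * y) ≡ 2 * q * l + y * (2 * (2 * q + 1))
          lemma₄ = solve-∀
        crossing : 4 * q * R * k * (1 + y) ≤ y * ℓ y
        crossing = begin
          4 * q * R * k * (1 + y)     ≤⟨ *-monoʳ-≤ (4 * q * R * k) (+-monoˡ-≤ y (≤-trans (s≤s z≤n) y≥3)) ⟩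
          4 * q * R * k * (y + y)     ≡⟨ lemma₅ q R k y ⟩
          y * (8 * q * R * k)         ≤⟨ *-monoʳ-≤ y (≤-trans (m≤n+m (8 * q * R * k) _) v₀≤ℓ) ⟩
          y * ℓ y                     ∎
          where
          lemma₅ : ∀ q R k y → 4 * q * R * k * (y + y) ≡ y * (8 * q * R * k)
          lemma₅ = solve-∀
        blocks : 4 * q * R * ((1 + β y) * W y) ≤ y * ℓ y
        blocks = *-cancelˡ-≤ 2 (begin
          2 * (4 * q * R * ((1 + β y) * (K * ℓ (y + 3))))   ≤⟨ *-monoʳ-≤ 2 (*-monoʳ-≤ (4 * q * R) (*-monoʳ-≤ (1 + β y) (*-monoʳ-≤ K (ℓ[y+3]≤2ℓ y y≥3)))) ⟩
          2 * (4 * q * R * ((1 + β y) * (K * (2 * ℓ y))))   ≡⟨ lemma₆ q R (β y) K (ℓ y) ⟩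
          (c + c * β y) * ℓ y                               ≤⟨ *-monoˡ-≤ (ℓ y) (+-mono-≤ c≤y cβ≤y) ⟩
          (y + y) * ℓ y                                     ≡⟨ lemma₇ y (ℓ y) ⟩
          2 * (y * ℓ y)                                     ∎)
          where
          lemma₆ : ∀ q R b K l → 2 * (4 * q * R * ((1 + b) * (K * (2 * l)))) ≡ (16 * q * R * K + 16 * q * R * K * b) * l
          lemma₆ = solve-∀
          lemma₇ : ∀ y l → (y + y) * l ≡ 2 * (y * l)
          lemma₇ = solve-∀

    -- Upper density of the windows hit by χ.

    module _ (meager-negligible : (E : ℕ → Bool) → Meager E → DensityZero (preimage f E))
             (k : ℕ) (k≥1 : 1 ≤ k) (Q : ℕ) .{{Q≢0 : NonZero Q}} (Q≡ : Q ≡ g ^ k) (Q≥2 : 2 ≤ Q)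
             (R : ℕ) (R≥1 : 1 ≤ R) (χ : ℕ → ℕ) (χ≤1 : ∀ d → χ d ≤ 1) where

      open Weights Q R Q≥2 R≥1 χ χ≤1

      exceptional : ℕ → ℕ → Bool
      exceptional i = preimage f (heavy ∘ shift g i)

      -- A block is counted once for each residue i at which it is exceptional.
      β : ℕ → ℕ
      β y = ∑ k (λ i → count (exceptional i) y)

      β-small : ∀ r → 1 ≤ r → ∃[ y₀ ] (∀ y → y₀ ≤ y → r * β y ≤ y)
      β-small r r≥1 = proj₁ uni , λ y y₀≤y → *-cancelˡ-≤′ k k≥1 (begin
        k * (r * β y)                                         ≡⟨ *-assoc k r (β y) ⟨
        k * r * β y                                           ≡⟨ ∑-*ˡ k (k * r) _ ⟨
        ∑ k (λ i → k * r * count (exceptional i) y)           ≤⟨ ∑-mono-< k (λ i i<k → proj₂ uni i i<k y y₀≤y) ⟩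
        ∑ k (λ _ → y)                                         ≡⟨ ∑-const k y ⟩
        k * y                                                 ∎)
        where
        open ≤-Reasoning
        uni = uniform-threshold (λ i y → k * r * count (exceptional i) y ≤ y)
          (λ i → meager-negligible _ (heavy-shift-meager Q R Q≥2 R≥1 χ χ≤1 g i) (k * r) (*-mono-≤ k≥1 r≥1)) k

      Tχ : ℕ → ℕ
      Tχ n = T n g (onPositive χ%) n

      -- As n < gⁿ, enlarging n positions to nk adds only zero truncations, and a multiple of k is
      -- what `T-residues` can sort.
      T-padded : ∀ φ → φ 0 ≡ 0 → ∀ n → T n g φ n ≡ ∑ k (λ i → T n Q φ (shift g i n))
      T-padded φ φ0 n = trans (sym (T-+ g n (n * k ∸ n) φ φ0 n (n<b^n g g≥2 n)))
        (trans (cong (λ z → T z g φ n) (m+[n∸m]≡n (m≤m*n n k {{>-nonZero k≥1}}))) (T-residues g k Q Q≡ n φ n))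

      -- A residue with light ⌊n/gⁱ⌋ has few hits; a heavy one is charged all ℓ(n) digits. The
      -- base-Q lengths of the ⌊n/gⁱ⌋ for i < k add up to ℓ(n), so the light bounds total at most ex
      -- ℓ(n).
      block-hits : ∀ n → Q * R * Tχ n ≤ ex * ℓ n + Q * R * ∑ k (λ i → bit (heavy (shift g i n)) * ℓ n)
      block-hits n = begin
        Q * R * Tχ n                                          ≡⟨ cong (Q * R *_) (T-padded (onPositive χ%) refl n) ⟩
        Q * R * ∑ k (λ i → hits n (shift g i n))              ≡⟨ ∑-*ˡ k (Q * R) _ ⟨
        ∑ k (λ i → Q * R * hits n (shift g i n))              ≤⟨ ∑-mono-< k residue ⟩
        ∑ k (λ i → ex * len n (shift g i n) + Q * R * (bit (heavy (shift g i n)) * ℓ n))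
          ≡⟨ ∑-+ k _ _ ⟩
        ∑ k (λ i → ex * len n (shift g i n)) + ∑ k (λ i → Q * R * (bit (heavy (shift g i n)) * ℓ n))
          ≡⟨ cong₂ _+_ (trans (∑-*ˡ k ex _) (cong (ex *_) (sym (T-padded (onPositive one) refl n)))) (∑-*ˡ k (Q * R) _) ⟩
        ex * ℓ n + Q * R * ∑ k (λ i → bit (heavy (shift g i n)) * ℓ n) ∎
        where
        open ≤-Reasoning
        residue : ∀ i → i < k → Q * R * hits n (shift g i n)
                              ≤ ex * len n (shift g i n) + Q * R * (bit (heavy (shift g i n)) * ℓ n)
        residue i i<k with heavy (shift g i n) in eq
        ... | false = ≤-trans (light⇒few-hits n (shift g i n) (shift≤ g i n) eq) (m≤m+n _ _)
        ... | true  = ≤-trans (*-monoʳ-≤ (Q * R) (begin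
          hits n (shift g i n)                  ≤⟨ hits≤len n (shift g i n) ⟩
          len n (shift g i n)                   ≤⟨ term≤∑ k (λ i → len n (shift g i n)) i i<k ⟩
          ∑ k (λ i → len n (shift g i n))       ≡⟨ T-padded (onPositive one) refl n ⟨
          ℓ n                                   ≡⟨ +-identityʳ (ℓ n) ⟨
          ℓ n + 0                               ∎)) (m≤n+m _ _)

      ∑-block-hits : ∀ y → Q * R * ∑ y (λ m → Tχ (f (suc m))) ≤ ex * L y + Q * R * (β y * W y)
      ∑-block-hits y = begin
        Q * R * ∑ y (λ m → Tχ (f (suc m)))                        ≡⟨ ∑-*ˡ y (Q * R) _ ⟨
        ∑ y (λ m → Q * R * Tχ (f (suc m)))                        ≤⟨ ∑-mono y (λ m → block-hits (f (suc m))) ⟩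
        ∑ y (λ m → ex * ℓ (f (suc m)) + Q * R * ∑ k (λ i → hv i m * ℓ (f (suc m)))) ≡⟨ ∑-+ y _ _ ⟩
        ∑ y (λ m → ex * ℓ (f (suc m))) + ∑ y (λ m → Q * R * ∑ k (λ i → hv i m * ℓ (f (suc m))))
          ≡⟨ cong₂ _+_ (trans (∑-*ˡ y ex _) (cong (ex *_) (sym (L≡∑ y)))) (∑-*ˡ y (Q * R) _) ⟩
        ex * L y + Q * R * ∑ y (λ m → ∑ k (λ i → hv i m * ℓ (f (suc m))))
          ≤⟨ +-monoʳ-≤ (ex * L y) (*-monoʳ-≤ (Q * R) (∑-mono-< y λ m m<y → ∑-mono k λ i →
               ≤-trans (*-monoʳ-≤ (hv i m) (ℓ[f]≤W m y (<⇒≤ m<y))) (≤-reflexive (*-comm (hv i m) (W y))))) ⟩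
        ex * L y + Q * R * ∑ y (λ m → ∑ k (λ i → W y * hv i m))   ≡⟨ cong (λ z → ex * L y + Q * R * z) sums ⟩
        ex * L y + Q * R * (β y * W y)                            ∎
        where
        open ≤-Reasoning
        hv : ℕ → ℕ → ℕ
        hv i m = bit (exceptional i (suc m))
        sums : ∑ y (λ m → ∑ k (λ i → W y * hv i m)) ≡ β y * W y
        sums = trans (∑-swap y k _) (trans (∑-cong k λ i → trans (∑-*ˡ y (W y) (hv i)) (cong (W y *_) (sym (count≡∑ (exceptional i) y))))
          (trans (∑-*ˡ k (W y) _) (*-comm (W y) (β y))))

      prefix-hits : ∀ y → hitsL χ% 0 (prefix y) ≤ ∑ y (λ m → Tχ (f (suc m))) + k * y
      prefix-hits zero    = z≤n
      prefix-hits (suc y) = begin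
        hitsL χ% 0 (prefix y ++ digits g n)                           ≡⟨ hitsL-++ χ% 0 (prefix y) (digits g n) ⟩
        hitsL χ% 0 (prefix y) + hitsL χ% (stateL 0 (prefix y)) (digits g n)
          ≤⟨ +-mono-≤ (prefix-hits y) (≤-trans
               (hitsL-digits g≥2 k Q Q≡ χ χ≤1 n n (stateL 0 (prefix y)) ≤-refl)
               (+-monoʳ-≤ (Tχ n) (m⊓n≤m k (length (digits g n))))) ⟩
        ∑ y (λ m → Tχ (f (suc m))) + k * y + (Tχ n + k)               ≡⟨ lemma (∑ y (λ m → Tχ (f (suc m)))) k y (Tχ n) ⟩
        ∑ y (λ m → Tχ (f (suc m))) + Tχ n + k * suc y                 ∎
        where
        open ≤-Reasoning
        n = f (suc y)
        lemma : ∀ s k y t → s + k * y + (t + k) ≡ s + t + k * suc y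
        lemma = solve-∀

      occ : ℕ → ℕ
      occ N = ∑ N (λ i → χ (window α k i))

      -- Indexing windows by their end shifts positions by k - 1; the k - 1 incomplete initial
      -- windows are added for free. Ends within the first y blocks go to `prefix-hits`, and each of
      -- the remaining N - L(y) + k - 1 counts as a hit.
      occ-bound : ∀ y N → L y ≤ N → N < L (suc y) →
        occ N ≤ ∑ y (λ m → Tχ (f (suc m))) + (k * (1 + y) + W y)
      occ-bound y N L≤N N<L = begin
        ∑ N (λ i → χ (window α k i))                  ≡⟨ ∑-cong N (λ i → trans (cong χ (sym (state-%-window α α<g k Q Q≡ i))) (cong (λ z → χ% (state α (z + i))) (sym k≡))) ⟩
        ∑ N (λ i → G (pred k + i))                    ≤⟨ m≤n+m (∑ N (λ i → G (pred k + i))) (∑ (pred k) G) ⟩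
        ∑ (pred k) G + ∑ N (λ i → G (pred k + i))     ≡⟨ ∑-split (pred k) N G ⟨
        ∑ (pred k + N) G                              ≡⟨ cong (λ z → ∑ z G) (trans (+-comm (pred k) N)
             (trans (cong (_+ pred k) (sym (m+[n∸m]≡n L≤N))) (+-assoc (L y) (N ∸ L y) (pred k)))) ⟩
        ∑ (L y + (N ∸ L y + pred k)) G                ≡⟨ ∑-split (L y) (N ∸ L y + pred k) G ⟩
        ∑ (L y) G + ∑ (N ∸ L y + pred k) (λ i → G (L y + i))
          ≤⟨ +-mono-≤ (≤-reflexive (∑-state χ% α (prefix y) 0 (α≡nth y))) (≤-trans
               (∑-mono (N ∸ L y + pred k) (λ i → χ≤1 (state α (suc (L y + i)) % Q)))
               (≤-reflexive (trans (∑-const (N ∸ L y + pred k) 1) (*-identityʳ (N ∸ L y + pred k))))) ⟩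
        hitsL χ% 0 (prefix y) + (N ∸ L y + pred k)    ≤⟨ +-mono-≤ (prefix-hits y) (+-mono-≤ partial pred[n]≤n) ⟩
        ∑ y (λ m → Tχ (f (suc m))) + k * y + (W y + k) ≡⟨ lemma (∑ y (λ m → Tχ (f (suc m)))) k y (W y) ⟩
        ∑ y (λ m → Tχ (f (suc m))) + (k * (1 + y) + W y) ∎
        where
        open ≤-Reasoning
        G : ℕ → ℕ
        G e = χ% (state α (suc e))
        k≡ : suc (pred k) ≡ k
        k≡ = suc-pred k {{>-nonZero k≥1}}
        lemma : ∀ s k y w → s + k * y + (w + k) ≡ s + (k * (1 + y) + w)
        lemma = solve-∀
        partial : N ∸ L y ≤ W y
        partial = ≤-trans (m≤n+o⇒m∸n≤o N (L y) (subst (N ≤_) (L-suc y) (<⇒≤ N<L))) (ℓ[f]≤W y y ≤-refl)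

      -- This is density s/Q + 2/R. One Q sits in `ex`, from the exponential moment; the other
      -- bounds all errors through `error-negligible`, the incomplete block being the 1 in 1 + β(y).
      upper-density : ∃[ N₀ ] (∀ N → N₀ ≤ N → Q * R * occ N ≤ (s * R + 2 * Q) * N)
      upper-density = L y₀ , λ N L[y₀]≤N →
        let y , lo , hi = enclosing-blocks N in bound N y lo hi (y₀≤ N y L[y₀]≤N hi)
        where
        open ≤-Reasoning
        negligible = error-negligible k R β β-small
        y₀ = proj₁ negligible
        y₀≤ : ∀ N y → L y₀ ≤ N → N < L (suc y) → y₀ ≤ y
        y₀≤ N y L[y₀]≤N hi = ≮⇒≥ λ y<y₀ → <⇒≱ hi (≤-trans (L-mono y<y₀) L[y₀]≤N)
        lemma₁ : ∀ e Q R b w x → e + Q * R * (b * w) + Q * R * (x + w) ≡ e + Q * (R * (x + (1 + b) * w))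
        lemma₁ = solve-∀
        lemma₂ : ∀ s R Q l → (s * R + Q) * l + Q * l ≡ (s * R + 2 * Q) * l
        lemma₂ = solve-∀
        bound : ∀ N y → L y ≤ N → N < L (suc y) → y₀ ≤ y → Q * R * occ N ≤ (s * R + 2 * Q) * N
        bound N y lo hi y₀≤y = begin
          Q * R * occ N                                             ≤⟨ *-monoʳ-≤ (Q * R) (occ-bound y N lo hi) ⟩
          Q * R * (hitsum + (k * (1 + y) + W y))                    ≡⟨ *-distribˡ-+ (Q * R) hitsum (k * (1 + y) + W y) ⟩
          Q * R * hitsum + Q * R * (k * (1 + y) + W y)              ≤⟨ +-monoˡ-≤ (Q * R * (k * (1 + y) + W y)) (∑-block-hits y) ⟩
          ex * L y + Q * R * (β y * W y) + Q * R * (k * (1 + y) + W y) ≡⟨ lemma₁ (ex * L y) Q R (β y) (W y) (k * (1 + y)) ⟩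
          ex * L y + Q * (R * (k * (1 + y) + (1 + β y) * W y))      ≤⟨ +-monoʳ-≤ (ex * L y) (*-monoʳ-≤ Q (proj₂ negligible y y₀≤y)) ⟩
          ex * L y + Q * L y                                        ≡⟨ lemma₂ s R Q (L y) ⟩
          (s * R + 2 * Q) * L y                                     ≤⟨ *-monoʳ-≤ (s * R + 2 * Q) lo ⟩
          (s * R + 2 * Q) * N                                       ∎
          where
          hitsum = ∑ y (λ m → Tχ (f (suc m)))

-- From one-sided densities to normality.

∣-∣≤ : ∀ {a b c} → a ≤ b + c → b ≤ a + c → ∣ a - b ∣ ≤ c
∣-∣≤ {a} {b} {c} a≤ b≤ with ∣m-n∣≡[m∸n]∨[n∸m] a b
... | inj₁ eq = subst (_≤ c) (sym eq) (m≤n+o⇒m∸n≤o a b a≤)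
... | inj₂ eq = subst (_≤ c) (sym eq) (m≤n+o⇒m∸n≤o b a b≤)

bit≤1 : ∀ b → bit b ≤ 1
bit≤1 true  = ≤-refl
bit≤1 false = z≤n

bit+bit-not : ∀ b → bit b + bit (not b) ≡ 1
bit+bit-not true  = refl
bit+bit-not false = refl

δ : ℕ → ℕ → Bool
δ v z = ⌊ z ≟ v ⌋

∑-δ-below : ∀ v n → n ≤ v → ∑ n (bit ∘ δ v) ≡ 0
∑-δ-below v zero    _   = refl
∑-δ-below v (suc n) n<v =
  cong₂ _+_ (∑-δ-below v n (<⇒≤ n<v)) (cong bit (⌊⌋-false (n ≟ v) (<⇒≢ n<v)))

-- This gives s ≤ 1 for the word; its counterpart `∑-δ≥1` gives s ≤ Q - 1 for the complement. The
-- two values make the one-sided densities meet at 1/Q.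
∑-δ≤1 : ∀ v n → ∑ n (bit ∘ δ v) ≤ 1
∑-δ≤1 v zero    = z≤n
∑-δ≤1 v (suc n) with n ≟ v
... | yes refl = ≤-reflexive (cong (_+ 1) (∑-δ-below v n ≤-refl))
... | no _     = ≤-trans (≤-reflexive (+-identityʳ _)) (∑-δ≤1 v n)

∑-δ≥1 : ∀ v n → v < n → 1 ≤ ∑ n (bit ∘ δ v)
∑-δ≥1 v n v<n = ≤-trans (≤-reflexive (sym δ-refl)) (term≤∑ n (bit ∘ δ v) v v<n)
  where
  δ-refl : bit (δ v v) ≡ 1
  δ-refl with v ≟ v
  ... | yes _  = refl
  ... | no v≢v = contradiction refl v≢v

occCount≡∑ : ∀ a xs N → occCount a xs N ≡ ∑ N (bit ∘ occursAt a xs)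
occCount≡∑ a xs zero    = refl
occCount≡∑ a xs (suc N) = cong (_+ bit (occursAt a xs N)) (occCount≡∑ a xs N)

length-word : ∀ g k (w : Vec (Fin g) k) → length (word g k w) ≡ k
length-word g k w = trans (length-map toℕ (toList w)) (length-toList w)

word-< : ∀ g k (w : Vec (Fin g) k) → All (_< g) (word g k w)
word-< g k w = All-map⁺ (All.universal toℕ<n (toList w))

theorem1p1 : (g : ℕ) → 2 ≤ g → (f : ℕ → ℕ) → ((m : ℕ) → 1 ≤ m → 1 ≤ f m) → WeaklyPolynomialGrowth f → ((E : ℕ → Bool) → Meager E → DensityZero (preimage f E)) → IsNormalSeq g (alphaDigit g f)
theorem1p1 (suc g-1) g≥2 f f≥1 ((q , q≥1 , x₁ , growth) , (K , K≥1 , f≤)) meager-negligible k k≥1 w r r≥1 =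
  N₁ ⊔ N₂ , λ N N₀≤N _ → begin
    r * ∣ Q * occCount α xs N - N ∣         ≡⟨ *-distribˡ-∣-∣ r (Q * occCount α xs N) N ⟩
    ∣ r * (Q * occCount α xs N) - r * N ∣   ≤⟨ ∣-∣≤ (above N (≤-trans (m≤m⊔n N₁ N₂) N₀≤N)) (below N (≤-trans (m≤n⊔m N₁ N₂) N₀≤N)) ⟩
    Q * N                                   ∎
  where
  open ≤-Reasoning
  open Base g-1
  open Concatenation g-1 g≥2 f f≥1
  Q = g ^ k
  xs = word g k w
  v = value xs
  instance
    Q≢0 : NonZero Q
    Q≢0 = m^n≢0 g k
  Q≥2 : 2 ≤ Q
  Q≥2 = ≤-trans g≥2 (≤-trans (≤-reflexive (sym (*-identityʳ g))) (^-monoʳ-≤ g k≥1))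
  v<Q : v < Q
  v<Q = subst (λ z → v < g ^ z) (length-word g k w) (value-< xs (word-< g k w))
  hit miss : ℕ → ℕ
  hit  = bit ∘ δ v
  miss = bit ∘ not ∘ δ v
  density : (χ : ℕ → ℕ) → (∀ d → χ d ≤ 1) →
            ∃[ N₀ ] (∀ N → N₀ ≤ N → r * (Q * ∑ N (λ i → χ (window α k i))) ≤ (∑ Q χ * r + Q) * N)
  density χ χ≤1 = proj₁ ud , λ N N₀≤N → *-cancelˡ-≤ 2 (begin
    2 * (r * (Q * ∑ N (λ i → χ (window α k i))))    ≡⟨ lemma₁ r Q _ ⟩
    Q * (2 * r) * ∑ N (λ i → χ (window α k i))      ≤⟨ proj₂ ud N N₀≤N ⟩
    (∑ Q χ * (2 * r) + 2 * Q) * N                   ≡⟨ lemma₂ (∑ Q χ) r Q N ⟩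
    2 * ((∑ Q χ * r + Q) * N)                       ∎)
    where
    -- R = 2r turns the bound s/Q + 2/R into s/Q + 1/r.
    ud = upper-density K K≥1 f≤ q q≥1 x₁ growth meager-negligible k k≥1 Q refl Q≥2
                       (2 * r) (*-mono-≤ (s≤s (z≤n {1})) r≥1) χ χ≤1
    lemma₁ : ∀ r Q o → 2 * (r * (Q * o)) ≡ Q * (2 * r) * o
    lemma₁ = solve-∀
    lemma₂ : ∀ s r Q N → (s * (2 * r) + 2 * Q) * N ≡ 2 * ((s * r + Q) * N)
    lemma₂ = solve-∀
  hit-density  = density hit (λ d → bit≤1 (δ v d))
  miss-density = density miss (λ d → bit≤1 (not (δ v d)))
  N₁ = proj₁ hit-density
  N₂ = proj₁ miss-density
  hits≡ : ∀ N → occCount α xs N ≡ ∑ N (λ i → hit (window α k i))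
  hits≡ N = trans (occCount≡∑ α xs N) (∑-cong N λ i → cong bit
    (trans (occursAt-window α α<g xs (word-< g k w) i) (cong (λ z → δ v (window α z i)) (length-word g k w))))
  hits+misses : ∀ n (F : ℕ → ℕ) → ∑ n (hit ∘ F) + ∑ n (miss ∘ F) ≡ n
  hits+misses n F = trans (sym (∑-+ n (hit ∘ F) (miss ∘ F)))
    (trans (∑-cong n λ i → bit+bit-not (δ v (F i))) (trans (∑-const n 1) (*-identityʳ n)))
  above : ∀ N → N₁ ≤ N → r * (Q * occCount α xs N) ≤ r * N + Q * N
  above N N₁≤N = begin
    r * (Q * occCount α xs N)                     ≡⟨ cong (λ z → r * (Q * z)) (hits≡ N) ⟩
    r * (Q * ∑ N (λ i → hit (window α k i)))      ≤⟨ proj₂ hit-density N N₁≤N ⟩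
    (∑ Q hit * r + Q) * N                         ≤⟨ *-monoˡ-≤ N (+-monoˡ-≤ Q (*-monoˡ-≤ r (∑-δ≤1 v Q))) ⟩
    (1 * r + Q) * N                               ≡⟨ lemma r Q N ⟩
    r * N + Q * N                                 ∎
    where
    lemma : ∀ r Q N → (1 * r + Q) * N ≡ r * N + Q * N
    lemma = solve-∀
  -- The misses have density at most 1 − 1/Q + 1/r.
  below : ∀ N → N₂ ≤ N → r * N ≤ r * (Q * occCount α xs N) + Q * N
  below N N₂≤N = +-cancelʳ-≤ (r * (Q * N)) _ _ (begin
    r * N + r * (Q * N)                           ≡⟨ cong (λ z → r * N + r * (Q * z)) (sym (trans (cong (_+ o₂) (hits≡ N)) (hits+misses N (window α k)))) ⟩
    r * N + r * (Q * (o₁ + o₂))                   ≡⟨ lemma₁ r N Q o₁ o₂ ⟩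
    r * (Q * o₁) + r * N + r * (Q * o₂)           ≤⟨ +-monoʳ-≤ (r * (Q * o₁) + r * N) (proj₂ miss-density N N₂≤N) ⟩
    r * (Q * o₁) + r * N + (∑ Q miss * r + Q) * N ≡⟨ lemma₂ (r * (Q * o₁)) r N (∑ Q miss) Q ⟩
    r * (Q * o₁) + Q * N + r * ((1 + ∑ Q miss) * N)
      ≤⟨ +-monoʳ-≤ (r * (Q * o₁) + Q * N) (*-monoʳ-≤ r (*-monoˡ-≤ N (≤-trans (+-monoˡ-≤ (∑ Q miss) (∑-δ≥1 v Q v<Q)) (≤-reflexive (hits+misses Q id))))) ⟩
    r * (Q * o₁) + Q * N + r * (Q * N)            ∎)
    where
    o₁ = occCount α xs N
    o₂ = ∑ N (λ i → miss (window α k i))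
    lemma₁ : ∀ r N Q a b → r * N + r * (Q * (a + b)) ≡ r * (Q * a) + r * N + r * (Q * b)
    lemma₁ = solve-∀
    lemma₂ : ∀ a r N m Q → a + r * N + (m * r + Q) * N ≡ a + Q * N + r * ((1 + m) * N)
    lemma₂ = solve-∀
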